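{- For all complex $q$ with $|q|<1$, $$F^{\rm od}_{\rm ed}(q)=\frac{q\,(-q;q^2)_\infty}{1-q}\left(1-\frac{(-q^2;q^2)_\infty}{(-q;q^2)_\infty}\right).$$
   Context: For $n\in\mathbb N_0\cup\{\infty\}$, $(a;q)_n:=\prod_{j=0}^{n-1}(1-aq^j)$. Define $$F^{\rm od}_{\rm ed}(q):=\sum_{n=0}^\infty q^{2n+2}(-q^2;q^2)_n(-q^{2n+3};q^2)_\infty,$$ the generating function for partitions into at least one even part, with even parts distinct, and odd parts distinct and all larger than every even part. -}

module Defs where

open import Data.Nat.Base as ℕ using (ℕ; zero; suc)
import Data.Nat.Properties as ℕ
open import Data.Product using (Σ; ∃; _×_; _,_; proj₁; proj₂)
open import Data.Rational.Base as ℚ using (ℚ; 0ℚ; 1ℚ; ½)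
import Data.Rational.Properties as ℚ
open import Data.Rational.Solver using (module +-*-Solver)
open import Relation.Binary.PropositionalEquality
  using (_≡_; refl; sym; trans; cong; cong₂; subst)

------------------------------------------------------------------------
-- Real numbers: Cauchy sequences of rationals, compared by the setoid
-- equality _≈ᵣ_

Cauchy : (ℕ → ℚ) → Set
Cauchy x = ∀ ε → 0ℚ ℚ.< ε →
  ∃ λ N → ∀ m n → N ℕ.≤ m → N ℕ.≤ n → ℚ.∣ x m ℚ.- x n ∣ ℚ.< ε

record ℝ : Set where
  constructor mkℝ
  field
    seq    : ℕ → ℚ
    cauchy : Cauchy seq

open ℝ public

infix 4 _≈ᵣ_ _<ᵣ_

_≈ᵣ_ : ℝ → ℝ → Set
x ≈ᵣ y = ∀ ε → 0ℚ ℚ.< ε →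
  ∃ λ N → ∀ n → N ℕ.≤ n → ℚ.∣ seq x n ℚ.- seq y n ∣ ℚ.< ε

-- The uniform gap ε makes this the order on limits, rather than the
-- eventual order on the representing sequences.
_<ᵣ_ : ℝ → ℝ → Set
x <ᵣ y = ∃ λ ε → 0ℚ ℚ.< ε ×
  (∃ λ N → ∀ n → N ℕ.≤ n → seq x n ℚ.+ ε ℚ.≤ seq y n)

module _ where
  open ℚ.≤-Reasoning
  open +-*-Solver

  private
    0<½* : ∀ {ε} → 0ℚ ℚ.< ε → 0ℚ ℚ.< ½ ℚ.* ε
    0<½* {ε} 0<ε = begin-strict
      0ℚ         ≡⟨ sym (ℚ.*-zeroʳ ½) ⟩
      ½ ℚ.* 0ℚ   <⟨ ℚ.*-monoʳ-<-pos ½ 0<ε ⟩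
      ½ ℚ.* ε    ∎

    ½+½ : ∀ ε → ½ ℚ.* ε ℚ.+ ½ ℚ.* ε ≡ ε
    ½+½ = solve 1 (λ ε → con ½ :* ε :+ con ½ :* ε := ε) refl

    0<* : ∀ {p q} → 0ℚ ℚ.< p → 0ℚ ℚ.< q → 0ℚ ℚ.< p ℚ.* q
    0<* {p} {q} 0<p 0<q = begin-strict
      0ℚ         ≡⟨ sym (ℚ.*-zeroʳ p) ⟩
      p ℚ.* 0ℚ   <⟨ ℚ.*-monoʳ-<-pos p {{ℚ.positive 0<p}} 0<q ⟩
      p ℚ.* q    ∎

    *-mono : ∀ {a b c d} → 0ℚ ℚ.≤ c → 0ℚ ℚ.≤ b → a ℚ.≤ b → c ℚ.≤ d →
             a ℚ.* c ℚ.≤ b ℚ.* d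
    *-mono {a} {b} {c} {d} 0≤c 0≤b a≤b c≤d = begin
      a ℚ.* c   ≤⟨ ℚ.*-monoʳ-≤-nonNeg c {{ℚ.nonNegative 0≤c}} a≤b ⟩
      b ℚ.* c   ≤⟨ ℚ.*-monoˡ-≤-nonNeg b {{ℚ.nonNegative 0≤b}} c≤d ⟩
      b ℚ.* d   ∎

  0<⇒nonZero : ∀ {p} → 0ℚ ℚ.< p → ℚ.NonZero p
  0<⇒nonZero {p} 0<p = ℚ.pos⇒nonZero p {{ℚ.positive 0<p}}

  const-cauchy : ∀ p → Cauchy (λ _ → p)
  const-cauchy p ε 0<ε = 0 , λ m n _ _ →
    subst (ℚ._< ε) (cong ℚ.∣_∣ (sym (ℚ.+-inverseʳ p))) 0<ε

  +-cauchy : ∀ x y → Cauchy x → Cauchy y → Cauchy (λ n → x n ℚ.+ y n)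
  +-cauchy x y cx cy ε 0<ε = N₁ ℕ.⊔ N₂ , λ m n N≤m N≤n → begin-strict
      ℚ.∣ (x m ℚ.+ y m) ℚ.- (x n ℚ.+ y n) ∣
        ≡⟨ cong ℚ.∣_∣ (solve 4 (λ a b c d → (a :+ b) :- (c :+ d) := (a :- c) :+ (b :- d))
             refl (x m) (y m) (x n) (y n)) ⟩
      ℚ.∣ (x m ℚ.- x n) ℚ.+ (y m ℚ.- y n) ∣
        ≤⟨ ℚ.∣p+q∣≤∣p∣+∣q∣ (x m ℚ.- x n) (y m ℚ.- y n) ⟩
      ℚ.∣ x m ℚ.- x n ∣ ℚ.+ ℚ.∣ y m ℚ.- y n ∣
        <⟨ ℚ.+-mono-<
             (p₁ m n (ℕ.m⊔n≤o⇒m≤o N₁ N₂ N≤m) (ℕ.m⊔n≤o⇒m≤o N₁ N₂ N≤n))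
             (p₂ m n (ℕ.m⊔n≤o⇒n≤o N₁ N₂ N≤m) (ℕ.m⊔n≤o⇒n≤o N₁ N₂ N≤n)) ⟩
      ½ ℚ.* ε ℚ.+ ½ ℚ.* ε
        ≡⟨ ½+½ ε ⟩
      ε ∎
    where
    ex = cx (½ ℚ.* ε) (0<½* 0<ε)
    ey = cy (½ ℚ.* ε) (0<½* 0<ε)
    N₁ = proj₁ ex
    N₂ = proj₁ ey
    p₁ = proj₂ ex
    p₂ = proj₂ ey

  neg-cauchy : ∀ x → Cauchy x → Cauchy (λ n → ℚ.- x n)
  neg-cauchy x cx ε 0<ε = proj₁ (cx ε 0<ε) , λ m n N≤m N≤n → begin-strict
    ℚ.∣ ℚ.- x m ℚ.- ℚ.- x n ∣
      ≡⟨ cong ℚ.∣_∣ (solve 2 (λ a b → :- a :- :- b := :- (a :- b)) refl (x m) (x n)) ⟩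
    ℚ.∣ ℚ.- (x m ℚ.- x n) ∣
      ≡⟨ ℚ.∣-p∣≡∣p∣ (x m ℚ.- x n) ⟩
    ℚ.∣ x m ℚ.- x n ∣
      <⟨ proj₂ (cx ε 0<ε) m n N≤m N≤n ⟩
    ε ∎

  eventually-bounded : ∀ x → Cauchy x →
    ∃ λ K → 0ℚ ℚ.< K × (∃ λ N → ∀ n → N ℕ.≤ n → ℚ.∣ x n ∣ ℚ.≤ K)
  eventually-bounded x cx = K , 0<K , N , bound
    where
    e = cx 1ℚ (ℚ.positive⁻¹ 1ℚ)
    N = proj₁ e
    K = 1ℚ ℚ.+ ℚ.∣ x N ∣
    0<K : 0ℚ ℚ.< K
    0<K = ℚ.+-mono-<-≤ (ℚ.positive⁻¹ 1ℚ) (ℚ.0≤∣p∣ (x N))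
    bound : ∀ n → N ℕ.≤ n → ℚ.∣ x n ∣ ℚ.≤ K
    bound n N≤n = begin
      ℚ.∣ x n ∣
        ≡⟨ cong ℚ.∣_∣ (solve 2 (λ a b → a := (a :- b) :+ b) refl (x n) (x N)) ⟩
      ℚ.∣ (x n ℚ.- x N) ℚ.+ x N ∣
        ≤⟨ ℚ.∣p+q∣≤∣p∣+∣q∣ (x n ℚ.- x N) (x N) ⟩
      ℚ.∣ x n ℚ.- x N ∣ ℚ.+ ℚ.∣ x N ∣
        ≤⟨ ℚ.+-monoˡ-≤ ℚ.∣ x N ∣ (ℚ.<⇒≤ (proj₂ e n N N≤n ℕ.≤-refl)) ⟩
      K ∎

  *-cauchy : ∀ x y → Cauchy x → Cauchy y → Cauchy (λ n → x n ℚ.* y n)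
  *-cauchy x y cx cy ε 0<ε = N , main
    where
    bx = eventually-bounded x cx
    by = eventually-bounded y cy
    K = proj₁ bx
    L = proj₁ by
    M = K ℚ.+ L
    0<K = proj₁ (proj₂ bx)
    0<L = proj₁ (proj₂ by)
    0<M : 0ℚ ℚ.< M
    0<M = ℚ.+-mono-< 0<K 0<L
    K≤M : K ℚ.≤ M
    K≤M = ℚ.≤-trans (ℚ.≤-reflexive (sym (ℚ.+-identityʳ K))) (ℚ.+-monoʳ-≤ K (ℚ.<⇒≤ 0<L))
    L≤M : L ℚ.≤ M
    L≤M = ℚ.≤-trans (ℚ.≤-reflexive (sym (ℚ.+-identityˡ L))) (ℚ.+-monoˡ-≤ L (ℚ.<⇒≤ 0<K))
    1/M = (ℚ.1/ M) {{0<⇒nonZero 0<M}}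
    0<1/M : 0ℚ ℚ.< 1/M
    0<1/M = ℚ.positive⁻¹ 1/M {{ℚ.1/pos⇒pos M {{ℚ.positive 0<M}}}}
    δ = (½ ℚ.* ε) ℚ.* 1/M
    0<δ : 0ℚ ℚ.< δ
    0<δ = 0<* (0<½* 0<ε) 0<1/M
    δM≡ : δ ℚ.* M ≡ ½ ℚ.* ε
    δM≡ = trans (ℚ.*-assoc (½ ℚ.* ε) 1/M M)
         (trans (cong ((½ ℚ.* ε) ℚ.*_) (ℚ.*-inverseˡ M {{0<⇒nonZero 0<M}}))
                (ℚ.*-identityʳ (½ ℚ.* ε)))
    ex = cx δ 0<δ
    ey = cy δ 0<δ
    N₁ = proj₁ ex ℕ.⊔ proj₁ ey
    N₂ = proj₁ (proj₂ (proj₂ bx)) ℕ.⊔ proj₁ (proj₂ (proj₂ by))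
    N = N₁ ℕ.⊔ N₂
    small : ∀ {a b} → ℚ.∣ a ∣ ℚ.< δ → ℚ.∣ b ∣ ℚ.≤ M → ℚ.∣ a ℚ.* b ∣ ℚ.< ½ ℚ.* ε
    small {a} {b} a<δ b≤M = begin-strict
      ℚ.∣ a ℚ.* b ∣         ≡⟨ ℚ.∣p*q∣≡∣p∣*∣q∣ a b ⟩
      ℚ.∣ a ∣ ℚ.* ℚ.∣ b ∣   ≤⟨ *-mono (ℚ.0≤∣p∣ b) (ℚ.0≤∣p∣ a) ℚ.≤-refl b≤M ⟩
      ℚ.∣ a ∣ ℚ.* M         <⟨ ℚ.*-monoˡ-<-pos M {{ℚ.positive 0<M}} a<δ ⟩
      δ ℚ.* M               ≡⟨ δM≡ ⟩
      ½ ℚ.* ε               ∎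
    main : ∀ m n → N ℕ.≤ m → N ℕ.≤ n → ℚ.∣ x m ℚ.* y m ℚ.- x n ℚ.* y n ∣ ℚ.< ε
    main m n N≤m N≤n = begin-strict
      ℚ.∣ x m ℚ.* y m ℚ.- x n ℚ.* y n ∣
        ≡⟨ cong ℚ.∣_∣ (solve 4 (λ a b c d →
             a :* b :- c :* d := (a :- c) :* b :+ (b :- d) :* c)
             refl (x m) (y m) (x n) (y n)) ⟩
      ℚ.∣ (x m ℚ.- x n) ℚ.* y m ℚ.+ (y m ℚ.- y n) ℚ.* x n ∣
        ≤⟨ ℚ.∣p+q∣≤∣p∣+∣q∣ ((x m ℚ.- x n) ℚ.* y m) ((y m ℚ.- y n) ℚ.* x n) ⟩
      ℚ.∣ (x m ℚ.- x n) ℚ.* y m ∣ ℚ.+ ℚ.∣ (y m ℚ.- y n) ℚ.* x n ∣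
        <⟨ ℚ.+-mono-<
             (small (proj₂ ex m n (r₁ N≤m) (r₁ N≤n))
                    (ℚ.≤-trans (proj₂ (proj₂ (proj₂ by)) m (r₄ N≤m)) L≤M))
             (small (proj₂ ey m n (r₂ N≤m) (r₂ N≤n))
                    (ℚ.≤-trans (proj₂ (proj₂ (proj₂ bx)) n (r₃ N≤n)) K≤M)) ⟩
      ½ ℚ.* ε ℚ.+ ½ ℚ.* ε
        ≡⟨ ½+½ ε ⟩
      ε ∎
      where
      a₁ = proj₁ ex
      a₂ = proj₁ ey
      b₁ = proj₁ (proj₂ (proj₂ bx))
      b₂ = proj₁ (proj₂ (proj₂ by))
      r₁ : ∀ {k} → N ℕ.≤ k → a₁ ℕ.≤ k
      r₁ h = ℕ.m⊔n≤o⇒m≤o a₁ a₂ (ℕ.m⊔n≤o⇒m≤o N₁ N₂ h)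
      r₂ : ∀ {k} → N ℕ.≤ k → a₂ ℕ.≤ k
      r₂ h = ℕ.m⊔n≤o⇒n≤o a₁ a₂ (ℕ.m⊔n≤o⇒m≤o N₁ N₂ h)
      r₃ : ∀ {k} → N ℕ.≤ k → b₁ ℕ.≤ k
      r₃ h = ℕ.m⊔n≤o⇒m≤o b₁ b₂ (ℕ.m⊔n≤o⇒n≤o N₁ N₂ h)
      r₄ : ∀ {k} → N ℕ.≤ k → b₂ ℕ.≤ k
      r₄ h = ℕ.m⊔n≤o⇒n≤o b₁ b₂ (ℕ.m⊔n≤o⇒n≤o N₁ N₂ h)

  0<⊔ : ∀ {c} → 0ℚ ℚ.< c → ∀ p → 0ℚ ℚ.< c ℚ.⊔ p
  0<⊔ {c} 0<c p = ℚ.<-≤-trans 0<c (ℚ.p≤p⊔q c p)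

  recip-seq : ∀ {c} → 0ℚ ℚ.< c → (ℕ → ℚ) → ℕ → ℚ
  recip-seq {c} 0<c x n = (ℚ.1/ (c ℚ.⊔ x n)) {{0<⇒nonZero (0<⊔ 0<c (x n))}}

  recip-cauchy : ∀ {c} x (0<c : 0ℚ ℚ.< c) →
    (∃ λ N → ∀ n → N ℕ.≤ n → c ℚ.≤ x n) → Cauchy x → Cauchy (recip-seq 0<c x)
  recip-cauchy {c} x 0<c (N₁ , c≤x) cx ε 0<ε = N₁ ℕ.⊔ N₂ , main
    where
    δ = ε ℚ.* (c ℚ.* c)
    0<δ : 0ℚ ℚ.< δ
    0<δ = 0<* 0<ε (0<* 0<c 0<c)
    ex = cx δ 0<δ
    N₂ = proj₁ ex
    u : ℕ → ℚ
    u n = c ℚ.⊔ x n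
    v : ℕ → ℚ
    v = recip-seq 0<c x
    0<u : ∀ n → 0ℚ ℚ.< u n
    0<u n = 0<⊔ 0<c (x n)
    uv : ∀ n → u n ℚ.* v n ≡ 1ℚ
    uv n = ℚ.*-inverseʳ (u n) {{0<⇒nonZero (0<u n)}}
    0<v : ∀ n → 0ℚ ℚ.< v n
    0<v n = ℚ.positive⁻¹ (v n) {{ℚ.1/pos⇒pos (u n) {{ℚ.positive (0<u n)}}}}
    cv≤1 : ∀ n → c ℚ.* v n ℚ.≤ 1ℚ
    cv≤1 n = begin
      c ℚ.* v n     ≤⟨ ℚ.*-monoʳ-≤-nonNeg (v n) {{ℚ.nonNegative (ℚ.<⇒≤ (0<v n))}} (ℚ.p≤p⊔q c (x n)) ⟩
      u n ℚ.* v n   ≡⟨ uv n ⟩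
      1ℚ            ∎
    diff : ∀ m n → v m ℚ.- v n ≡ (u n ℚ.- u m) ℚ.* (v m ℚ.* v n)
    diff m n = begin-equality
      v m ℚ.- v n
        ≡⟨ cong₂ ℚ._-_ (sym (ℚ.*-identityʳ (v m))) (sym (ℚ.*-identityʳ (v n))) ⟩
      v m ℚ.* 1ℚ ℚ.- v n ℚ.* 1ℚ
        ≡⟨ cong₂ (λ s t → v m ℚ.* s ℚ.- v n ℚ.* t) (sym (uv n)) (sym (uv m)) ⟩
      v m ℚ.* (u n ℚ.* v n) ℚ.- v n ℚ.* (u m ℚ.* v m)
        ≡⟨ solve 4 (λ a b c d → a :* (b :* d) :- d :* (c :* a) := (b :- c) :* (a :* d))
             refl (v m) (u n) (u m) (v n) ⟩
      (u n ℚ.- u m) ℚ.* (v m ℚ.* v n) ∎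
    main : ∀ m n → N₁ ℕ.⊔ N₂ ℕ.≤ m → N₁ ℕ.⊔ N₂ ℕ.≤ n → ℚ.∣ v m ℚ.- v n ∣ ℚ.< ε
    main m n N≤m N≤n = begin-strict
      ℚ.∣ v m ℚ.- v n ∣
        ≡⟨ cong ℚ.∣_∣ (diff m n) ⟩
      ℚ.∣ (u n ℚ.- u m) ℚ.* (v m ℚ.* v n) ∣
        ≡⟨ ℚ.∣p*q∣≡∣p∣*∣q∣ (u n ℚ.- u m) (v m ℚ.* v n) ⟩
      ℚ.∣ u n ℚ.- u m ∣ ℚ.* ℚ.∣ v m ℚ.* v n ∣
        ≡⟨ cong₂ ℚ._*_
             (cong₂ (λ s t → ℚ.∣ s ℚ.- t ∣)
               (ℚ.p≤q⇒p⊔q≡q (c≤x n (ℕ.m⊔n≤o⇒m≤o N₁ N₂ N≤n)))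
               (ℚ.p≤q⇒p⊔q≡q (c≤x m (ℕ.m⊔n≤o⇒m≤o N₁ N₂ N≤m))))
             (ℚ.0≤p⇒∣p∣≡p (ℚ.<⇒≤ 0<vv)) ⟩
      ℚ.∣ x n ℚ.- x m ∣ ℚ.* (v m ℚ.* v n)
        <⟨ ℚ.*-monoˡ-<-pos (v m ℚ.* v n) {{ℚ.positive 0<vv}}
             (proj₂ ex n m (ℕ.m⊔n≤o⇒n≤o N₁ N₂ N≤n) (ℕ.m⊔n≤o⇒n≤o N₁ N₂ N≤m)) ⟩
      (ε ℚ.* (c ℚ.* c)) ℚ.* (v m ℚ.* v n)
        ≡⟨ solve 4 (λ e c a b → (e :* (c :* c)) :* (a :* b) := e :* ((c :* a) :* (c :* b)))
             refl ε c (v m) (v n) ⟩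
      ε ℚ.* ((c ℚ.* v m) ℚ.* (c ℚ.* v n))
        ≤⟨ ℚ.*-monoˡ-≤-nonNeg ε {{ℚ.nonNegative (ℚ.<⇒≤ 0<ε)}}
             (*-mono (ℚ.<⇒≤ (0<* 0<c (0<v n))) (ℚ.<⇒≤ (ℚ.positive⁻¹ 1ℚ)) (cv≤1 m) (cv≤1 n)) ⟩
      ε ℚ.* (1ℚ ℚ.* 1ℚ)
        ≡⟨ ℚ.*-identityʳ ε ⟩
      ε ∎
      where
      0<vv = 0<* (0<v m) (0<v n)

infixl 6 _+ᵣ_
infixl 7 _*ᵣ_
infix  8 -ᵣ_

0ℝ 1ℝ : ℝ
0ℝ = mkℝ (λ _ → 0ℚ) (const-cauchy 0ℚ)
1ℝ = mkℝ (λ _ → 1ℚ) (const-cauchy 1ℚ)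

_+ᵣ_ _*ᵣ_ : ℝ → ℝ → ℝ
x +ᵣ y = mkℝ (λ n → seq x n ℚ.+ seq y n) (+-cauchy (seq x) (seq y) (cauchy x) (cauchy y))
x *ᵣ y = mkℝ (λ n → seq x n ℚ.* seq y n) (*-cauchy (seq x) (seq y) (cauchy x) (cauchy y))

-ᵣ_ : ℝ → ℝ
-ᵣ x = mkℝ (λ n → ℚ.- seq x n) (neg-cauchy (seq x) (cauchy x))

-- The witness of 0 < x bounds x below by a rational c > 0 from some index
-- on; truncating the earlier terms below at c does not change the limit
-- and makes every term invertible.
recip : (x : ℝ) → 0ℝ <ᵣ x → ℝ
recip x (c , 0<c , N , c≤x) =
  mkℝ (recip-seq 0<c (seq x))
      (recip-cauchy (seq x) 0<c
        (N , λ n N≤n → subst (ℚ._≤ seq x n) (ℚ.+-identityˡ c) (c≤x n N≤n))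
        (cauchy x))

------------------------------------------------------------------------
-- Complex numbers

record ℂ : Set where
  constructor _+i_
  field
    re im : ℝ

open ℂ public

infix  4 _≈_ _#0 ∣_∣<_
infixl 6 _+_ _-_
infixl 7 _*_ _/_[_]
infix  8 -_
infixr 9 _^_

_≈_ : ℂ → ℂ → Set
z ≈ w = re z ≈ᵣ re w × im z ≈ᵣ im w

0ℂ 1ℂ : ℂ
0ℂ = 0ℝ +i 0ℝ
1ℂ = 1ℝ +i 0ℝ

-_ : ℂ → ℂ
- z = (-ᵣ re z) +i (-ᵣ im z)

_+_ _-_ _*_ : ℂ → ℂ → ℂ
z + w = (re z +ᵣ re w) +i (im z +ᵣ im w)
z - w = z + (- w)
z * w = (re z *ᵣ re w +ᵣ -ᵣ (im z *ᵣ im w)) +i (re z *ᵣ im w +ᵣ im z *ᵣ re w)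

_^_ : ℂ → ℕ → ℂ
z ^ zero  = 1ℂ
z ^ suc n = z * z ^ n

normSq : ℂ → ℝ
normSq z = re z *ᵣ re z +ᵣ im z *ᵣ im z

-- |z| < r, with the square root in |z| cleared
∣_∣<_ : ℂ → ℝ → Set
∣ z ∣< r = 0ℝ <ᵣ r × normSq z <ᵣ r *ᵣ r

-- z ≠ 0 in its constructive form |z| > 0, which is what division requires
_#0 : ℂ → Set
z #0 = 0ℝ <ᵣ normSq z

-- z / w = z · w̄ / |w|²
_/_[_] : (z w : ℂ) → w #0 → ℂ
z / w [ w#0 ] = z * ((re w *ᵣ s) +i (-ᵣ (im w) *ᵣ s))
  where s = recip (normSq w) w#0

------------------------------------------------------------------------
-- Limits, series and q-Pochhammer symbols

infix 4 _⟶_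

_⟶_ : (ℕ → ℂ) → ℂ → Set
f ⟶ L = ∀ ε → 0ℝ <ᵣ ε → ∃ λ N → ∀ n → N ℕ.≤ n → ∣ f n - L ∣< ε

∑<_ : ℕ → (ℕ → ℂ) → ℂ
(∑< zero)  f = 0ℂ
(∑< suc n) f = (∑< n) f + f n

∏<_ : ℕ → (ℕ → ℂ) → ℂ
(∏< zero)  f = 1ℂ
(∏< suc n) f = (∏< n) f * f n

_isSumOf_ : ℂ → (ℕ → ℂ) → Set
S isSumOf f = (λ N → (∑< N) f) ⟶ S

poch : (a q : ℂ) → ℕ → ℂ
poch a q n = (∏< n) λ j → 1ℂ - a * q ^ j

-- P = (a;q)_∞.  The infinite product is a relation because the partial
-- products converge only for suitable a and q; limits are unique up to _≈_.
_isPoch∞[_,_] : (P a q : ℂ) → Set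
P isPoch∞[ a , q ] = poch a q ⟶ P

-- F = ∑_{n≥0} q^{2n+2} (-q²;q²)_n (-q^{2n+3};q²)_∞, where T n is the
-- infinite product in the n-th term
_isFodEd[_] : (F q : ℂ) → Set
F isFodEd[ q ] = Σ (ℕ → ℂ) λ T →
  (∀ n → T n isPoch∞[ - (q ^ (2 ℕ.* n ℕ.+ 3)) , q ^ 2 ]) ×
  F isSumOf (λ n → q ^ (2 ℕ.* n ℕ.+ 2) * poch (- (q ^ 2)) (q ^ 2) n * T n)

{-# OPTIONS --safe #-}

-- Put Gₙ = (-q²;q²)ₙ (-q²ⁿ⁺¹;q²)_∞.  Splitting one factor off each product
-- gives (1 - q) q²ⁿ⁺² (-q²;q²)ₙ (-q²ⁿ⁺³;q²)_∞ = q (Gₙ - Gₙ₊₁), so the series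
-- telescopes to q (G₀ - lim Gₙ) / (1 - q), where G₀ = (-q;q²)_∞ and
-- Gₙ → (-q²;q²)_∞.
--
-- A complex number is a sequence of Gaussian rationals, so every estimate is
-- made on these, with bounds uniform over |q| ≤ ρ for a rational ρ < 1; an
-- infinite product is the diagonal sequence whose k-th entry is the k-th
-- partial product at the k-th approximations.  The elementary inequality
-- (1 - t)ᵐ ≤ (1 - t)(1 - ρt)ᵐ, valid once m (1 - ρ) ≥ 1, yields
-- ∏ (1 - α ρʲ) ≥ (1 - α)ᵐ, which keeps the products away from 0 and,
-- through (1 + t)(1 - t) ≤ 1, bounds them above.

module Submission where

open import Data.Nat.Base as ℕ using (ℕ; zero; suc)
import Data.Nat.Properties as ℕ
open import Data.Integer.Base as ℤ using (+_; -[1+_])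
import Data.Integer.Properties as ℤ
open import Data.Product using (Σ; ∃; _×_; _,_; proj₁; proj₂)
open import Data.Sum.Base using (inj₁; inj₂)
open import Data.Rational.Base as ℚ using (ℚ; 0ℚ; 1ℚ; ½; mkℚ)
import Data.Rational.Properties as ℚ
import Data.Rational.Unnormalised.Base as ℚᵘ
import Data.Rational.Unnormalised.Properties as ℚᵘ
open import Data.Rational.Literals using (fromℤ)
open import Data.Rational.Solver using (module +-*-Solver)
open import Algebra.Bundles using (CommutativeRing)
open import Relation.Binary.PropositionalEquality
  using (_≡_; refl; sym; trans; cong; cong₂; subst; subst₂; module ≡-Reasoning)
import Algebra.Properties.CommutativeSemiring.Exp as Exp
open import Algebra.Consequences.Propositional
  using (comm∧idˡ⇒id; comm∧invˡ⇒inv; comm∧distrˡ⇒distrʳ)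
import Algebra.Solver.Ring.Simple as RingSolver
open import Algebra.Solver.Ring.AlmostCommutativeRing using (fromCommutativeRing)
open import Relation.Binary.Definitions using (DecidableEquality)
open import Relation.Binary.PropositionalEquality.Algebra using (isMagma)
open import Relation.Nullary.Decidable using (map′; _×-dec_)
open import Defs

open Exp (CommutativeRing.commutativeSemiring ℚ.+-*-commutativeRing)
  using () renaming (_^_ to _^ℚ_)

-- Rational inequalities

module _ where
  open +-*-Solver
  open ℚ.≤-Reasoning

  ≤-by : ∀ {a b} d → 0ℚ ℚ.≤ d → a ℚ.+ d ≡ b → a ℚ.≤ b
  ≤-by {a} d 0≤d refl =
    subst (ℚ._≤ a ℚ.+ d) (ℚ.+-identityʳ a) (ℚ.+-monoʳ-≤ a 0≤d)

  0≤1 : 0ℚ ℚ.≤ 1ℚ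
  0≤1 = ℚ.nonNegative⁻¹ 1ℚ

  0≤+ : ∀ {a b} → 0ℚ ℚ.≤ a → 0ℚ ℚ.≤ b → 0ℚ ℚ.≤ a ℚ.+ b
  0≤+ 0≤a 0≤b = ℚ.+-mono-≤ 0≤a 0≤b

  *-mono-≤ : ∀ {a b c d} → 0ℚ ℚ.≤ b → 0ℚ ℚ.≤ c → a ℚ.≤ b → c ℚ.≤ d →
             a ℚ.* c ℚ.≤ b ℚ.* d
  *-mono-≤ {b = b} {c} 0≤b 0≤c a≤b c≤d = ℚ.≤-trans
    (ℚ.*-monoʳ-≤-nonNeg c {{ℚ.nonNegative 0≤c}} a≤b)
    (ℚ.*-monoˡ-≤-nonNeg b {{ℚ.nonNegative 0≤b}} c≤d)

  0≤* : ∀ {a b} → 0ℚ ℚ.≤ a → 0ℚ ℚ.≤ b → 0ℚ ℚ.≤ a ℚ.* b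
  0≤* {a} {b} 0≤a 0≤b = *-mono-≤ {0ℚ} {a} {0ℚ} 0≤a ℚ.≤-refl 0≤a 0≤b

  0<* : ∀ {a b} → 0ℚ ℚ.< a → 0ℚ ℚ.< b → 0ℚ ℚ.< a ℚ.* b
  0<* {a} {b} 0<a 0<b =
    ℚ.positive⁻¹ _ {{ℚ.pos*pos⇒pos a {{ℚ.positive 0<a}} b {{ℚ.positive 0<b}}}}

  0≤x*x : ∀ x → 0ℚ ℚ.≤ x ℚ.* x
  0≤x*x x with ℚ.≤-total 0ℚ x
  ... | inj₁ 0≤x = 0≤* 0≤x 0≤x
  ... | inj₂ x≤0 = ℚ.nonNegative⁻¹ _
    {{ℚ.nonPos*nonPos⇒nonPos x {{ℚ.nonPositive x≤0}} x {{ℚ.nonPositive x≤0}}}}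

  -- Stands in for taking square roots: were r < x, then r² ≤ r x < x².
  x*x-cancel-≤ : ∀ {x r} → 0ℚ ℚ.≤ r → x ℚ.* x ℚ.≤ r ℚ.* r → x ℚ.≤ r
  x*x-cancel-≤ {x} {r} 0≤r xx≤rr = ℚ.≮⇒≥ λ r<x → ℚ.<-irrefl refl (begin-strict
    r ℚ.* r   ≤⟨ ℚ.*-monoˡ-≤-nonNeg r {{ℚ.nonNegative 0≤r}} (ℚ.<⇒≤ r<x) ⟩
    r ℚ.* x   <⟨ ℚ.*-monoˡ-<-pos x {{ℚ.positive (ℚ.≤-<-trans 0≤r r<x)}} r<x ⟩
    x ℚ.* x   ≤⟨ xx≤rr ⟩
    r ℚ.* r   ∎)

  x*x≤r*r⇒∣x∣≤r : ∀ {x r} → 0ℚ ℚ.≤ r → x ℚ.* x ℚ.≤ r ℚ.* r → ℚ.∣ x ∣ ℚ.≤ r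
  x*x≤r*r⇒∣x∣≤r {x} {r} 0≤r xx≤rr = x*x-cancel-≤ 0≤r (begin
    ℚ.∣ x ∣ ℚ.* ℚ.∣ x ∣   ≡⟨ ℚ.∣p*q∣≡∣p∣*∣q∣ x x ⟨
    ℚ.∣ x ℚ.* x ∣         ≡⟨ ℚ.0≤p⇒∣p∣≡p (0≤x*x x) ⟩
    x ℚ.* x               ≤⟨ xx≤rr ⟩
    r ℚ.* r               ∎)

  x≤∣x∣ : ∀ x → x ℚ.≤ ℚ.∣ x ∣
  x≤∣x∣ x = x*x-cancel-≤ (ℚ.0≤∣p∣ x) (ℚ.≤-reflexive
    (trans (sym (ℚ.0≤p⇒∣p∣≡p (0≤x*x x))) (ℚ.∣p*q∣≡∣p∣*∣q∣ x x)))

  0<½* : ∀ {e} → 0ℚ ℚ.< e → 0ℚ ℚ.< ½ ℚ.* e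
  0<½* = 0<* (ℚ.positive⁻¹ ½)

  ½e+½e≡e : ∀ e → ½ ℚ.* e ℚ.+ ½ ℚ.* e ≡ e
  ½e+½e≡e = solve 1 (λ e → con ½ :* e :+ con ½ :* e := e) refl

  ½e<e : ∀ {e} → 0ℚ ℚ.< e → ½ ℚ.* e ℚ.< e
  ½e<e {e} 0<e = begin-strict
    ½ ℚ.* e                ≡⟨ ℚ.+-identityʳ (½ ℚ.* e) ⟨
    ½ ℚ.* e ℚ.+ 0ℚ         <⟨ ℚ.+-monoʳ-< (½ ℚ.* e) (0<½* 0<e) ⟩
    ½ ℚ.* e ℚ.+ ½ ℚ.* e    ≡⟨ ½e+½e≡e e ⟩
    e                      ∎

  x≤y⇒0≤y-x : ∀ {x y} → x ℚ.≤ y → 0ℚ ℚ.≤ y ℚ.- x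
  x≤y⇒0≤y-x {x} {y} x≤y =
    subst (ℚ._≤ y ℚ.- x) (ℚ.+-inverseʳ x) (ℚ.+-monoˡ-≤ (ℚ.- x) x≤y)

  0<1-x : ∀ {x} → x ℚ.< 1ℚ → 0ℚ ℚ.< 1ℚ ℚ.- x
  0<1-x {x} x<1 = subst (ℚ._< 1ℚ ℚ.- x) (ℚ.+-inverseʳ x) (ℚ.+-monoˡ-< (ℚ.- x) x<1)

  inverse : ∀ {x} → 0ℚ ℚ.< x → ∃ λ y → 0ℚ ℚ.< y × x ℚ.* y ≡ 1ℚ
  inverse {x} 0<x = _ , ℚ.positive⁻¹ _ {{ℚ.1/pos⇒pos x {{ℚ.positive 0<x}}}} ,
    ℚ.*-inverseʳ x {{0<⇒nonZero 0<x}}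

  abstract
    -- Kept abstract, so that later proofs use this embedding only through the facts below and never
    -- through the underlying fractions.
    ι : ℕ → ℚ
    ι n = fromℤ (+ n)

    ι-zero : ι 0 ≡ 0ℚ
    ι-zero = refl

    0≤ι : ∀ n → 0ℚ ℚ.≤ ι n
    0≤ι n = ℚ.nonNegative⁻¹ (ι n)

    ι-suc : ∀ n → ι (suc n) ≡ 1ℚ ℚ.+ ι n
    ι-suc n = ℚ.toℚᵘ-injective (ℚᵘ.≃-sym (ℚᵘ.≃-trans (ℚ.toℚᵘ-homo-+ 1ℚ (ι n))
      (ℚᵘ.*≡* (cong (ℤ._* + 1)
        (cong (ℤ._+_ (+ 1)) (ℤ.*-identityʳ (+ n)))))))

    archimedean : ∀ x → ∃ λ n → x ℚ.≤ ι n
    archimedean (mkℚ (+ n) d _) =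
      -- A nonnegative fraction is at most its numerator, because the denominator is at least 1.
      n , ℚ.*≤* (ℤ.*-monoˡ-≤-nonNeg (+ n) (ℤ.+≤+ (ℕ.s≤s ℕ.z≤n)))
    archimedean x@(mkℚ -[1+ n ] d _) =
      0 , ℚ.<⇒≤ (ℚ.negative⁻¹ x)

  archimedean* : ∀ {x} → 0ℚ ℚ.< x → ∀ c → ∃ λ n → c ℚ.≤ ι n ℚ.* x
  archimedean* {x} 0<x c with inverse 0<x
  ... | y , 0<y , xy≡1 with archimedean (c ℚ.* y)
  ... | n , cy≤n = n , (begin
    c                   ≡⟨ ℚ.*-identityʳ c ⟨
    c ℚ.* 1ℚ            ≡⟨ cong (c ℚ.*_) xy≡1 ⟨
    c ℚ.* (x ℚ.* y)     ≡⟨ solve 3 (λ c x y → c :* (x :* y) := c :* y :* x) refl c x y ⟩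
    c ℚ.* y ℚ.* x       ≤⟨ ℚ.*-monoʳ-≤-nonNeg x {{ℚ.nonNegative (ℚ.<⇒≤ 0<x)}} cy≤n ⟩
    ι n ℚ.* x           ∎)

  0≤^ : ∀ {x} → 0ℚ ℚ.≤ x → ∀ n → 0ℚ ℚ.≤ x ^ℚ n
  0≤^ 0≤x zero    = 0≤1
  0≤^ 0≤x (suc n) = 0≤* 0≤x (0≤^ 0≤x n)

  0<^ : ∀ {x} → 0ℚ ℚ.< x → ∀ n → 0ℚ ℚ.< x ^ℚ n
  0<^ 0<x zero    = ℚ.positive⁻¹ 1ℚ
  0<^ 0<x (suc n) = 0<* 0<x (0<^ 0<x n)

  ^-monoˡ-≤ : ∀ {x y} → 0ℚ ℚ.≤ x → x ℚ.≤ y → ∀ n → x ^ℚ n ℚ.≤ y ^ℚ n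
  ^-monoˡ-≤ 0≤x x≤y zero    = ℚ.≤-refl
  ^-monoˡ-≤ 0≤x x≤y (suc n) =
    *-mono-≤ (ℚ.≤-trans 0≤x x≤y) (0≤^ 0≤x n) x≤y (^-monoˡ-≤ 0≤x x≤y n)

  ^≤1 : ∀ {x} → 0ℚ ℚ.≤ x → x ℚ.≤ 1ℚ → ∀ n → x ^ℚ n ℚ.≤ 1ℚ
  ^≤1 0≤x x≤1 zero    = ℚ.≤-refl
  ^≤1 0≤x x≤1 (suc n) = *-mono-≤ 0≤1 (0≤^ 0≤x n) x≤1 (^≤1 0≤x x≤1 n)

  ^-antimonoʳ-≤ : ∀ {x} → 0ℚ ℚ.≤ x → x ℚ.≤ 1ℚ →
                  ∀ {m n} → m ℕ.≤ n → x ^ℚ n ℚ.≤ x ^ℚ m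
  ^-antimonoʳ-≤ 0≤x x≤1 {n = n} ℕ.z≤n       = ^≤1 0≤x x≤1 n
  ^-antimonoʳ-≤ 0≤x x≤1 (ℕ.s≤s {m} {n} m≤n) =
    *-mono-≤ 0≤x (0≤^ 0≤x n) ℚ.≤-refl (^-antimonoʳ-≤ 0≤x x≤1 {m} {n} m≤n)

  -- Bernoulli's inequality (1 + n y/x) ≤ (1 + y/x)ⁿ, multiplied by xⁿ⁺¹.
  bernoulli : ∀ {x y} → 0ℚ ℚ.≤ x → 0ℚ ℚ.≤ y → ∀ n →
    (x ℚ.+ ι n ℚ.* y) ℚ.* x ^ℚ n ℚ.≤ (x ℚ.+ y) ^ℚ n ℚ.* x
  bernoulli {x} {y} 0≤x 0≤y zero = ℚ.≤-reflexive
    (trans (cong (λ k → (x ℚ.+ k ℚ.* y) ℚ.* 1ℚ) ι-zero)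
      (solve 2 (λ x y → (x :+ con 0ℚ :* y) :* con 1ℚ := con 1ℚ :* x) refl x y))
  bernoulli {x} {y} 0≤x 0≤y (suc n) = begin
    (x ℚ.+ ι (suc n) ℚ.* y) ℚ.* (x ℚ.* p)
      ≡⟨ cong (λ k → (x ℚ.+ k ℚ.* y) ℚ.* (x ℚ.* p)) (ι-suc n) ⟩
    (x ℚ.+ (1ℚ ℚ.+ ι n) ℚ.* y) ℚ.* (x ℚ.* p)
      ≤⟨ ≤-by (ι n ℚ.* (y ℚ.* y) ℚ.* p)
           (0≤* (0≤* (0≤ι n) (0≤x*x y)) (0≤^ 0≤x n))
           (solve 4 (λ x y k p →
              (x :+ (con 1ℚ :+ k) :* y) :* (x :* p) :+ k :* (y :* y) :* p
              := (x :+ y) :* ((x :+ k :* y) :* p)) refl x y (ι n) p) ⟩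
    (x ℚ.+ y) ℚ.* ((x ℚ.+ ι n ℚ.* y) ℚ.* p)
      ≤⟨ ℚ.*-monoˡ-≤-nonNeg (x ℚ.+ y) {{ℚ.nonNegative (0≤+ 0≤x 0≤y)}}
           (bernoulli 0≤x 0≤y n) ⟩
    (x ℚ.+ y) ℚ.* ((x ℚ.+ y) ^ℚ n ℚ.* x)
      ≡⟨ ℚ.*-assoc (x ℚ.+ y) _ x ⟨
    (x ℚ.+ y) ^ℚ suc n ℚ.* x ∎
    where p = x ^ℚ n

  module _ {ρ} (0≤ρ : 0ℚ ℚ.≤ ρ) (ρ<1 : ρ ℚ.< 1ℚ) where

    -- Bernoulli's inequality with x = ρ and y = 1 - ρ gives N (1 - ρ) ρᴺ ≤ 1. It is therefore
    -- enough to take N with c ≤ N (1 - ρ) e; later powers are smaller still. The multiplied form of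
    -- `bernoulli` also covers ρ = 0.
    powers-vanish : ∀ c {e} → 0ℚ ℚ.≤ c → 0ℚ ℚ.< e →
      ∃ λ N → ∀ n → N ℕ.≤ n → c ℚ.* ρ ^ℚ n ℚ.≤ e
    powers-vanish c {e} 0≤c 0<e = N , λ n N≤n → begin
      c ℚ.* ρ ^ℚ n
        ≤⟨ *-mono-≤ 0≤c (0≤^ 0≤ρ n) ℚ.≤-refl (^-antimonoʳ-≤ 0≤ρ (ℚ.<⇒≤ ρ<1) N≤n) ⟩
      c ℚ.* ρ ^ℚ N
        ≤⟨ ℚ.*-monoʳ-≤-nonNeg (ρ ^ℚ N) {{ℚ.nonNegative (0≤^ 0≤ρ N)}} c≤ ⟩
      ι N ℚ.* (δ ℚ.* e) ℚ.* ρ ^ℚ N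
        ≤⟨ ≤-by (ρ ℚ.* (e ℚ.* ρ ^ℚ N)) (0≤* 0≤ρ (0≤* (ℚ.<⇒≤ 0<e) (0≤^ 0≤ρ N)))
             (solve 5 (λ k d e p r → k :* (d :* e) :* p :+ r :* (e :* p)
                        := e :* ((r :+ k :* d) :* p)) refl (ι N) δ e (ρ ^ℚ N) ρ) ⟩
      e ℚ.* ((ρ ℚ.+ ι N ℚ.* δ) ℚ.* ρ ^ℚ N)
        ≤⟨ ℚ.*-monoˡ-≤-nonNeg e {{ℚ.nonNegative (ℚ.<⇒≤ 0<e)}}
             (bernoulli 0≤ρ (ℚ.<⇒≤ (0<1-x ρ<1)) N) ⟩
      e ℚ.* ((ρ ℚ.+ δ) ^ℚ N ℚ.* ρ)
        ≤⟨ ℚ.*-monoˡ-≤-nonNeg e {{ℚ.nonNegative (ℚ.<⇒≤ 0<e)}}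
             (*-mono-≤ 0≤1 0≤ρ (^≤1 (0≤+ 0≤ρ (ℚ.<⇒≤ (0<1-x ρ<1))) ρ+δ≤1 N) (ℚ.<⇒≤ ρ<1)) ⟩
      e ℚ.* (1ℚ ℚ.* 1ℚ)
        ≡⟨ ℚ.*-identityʳ e ⟩
      e ∎
      where
      N,c≤ = archimedean* (0<* (0<1-x ρ<1) 0<e) c
      N = proj₁ N,c≤
      c≤ = proj₂ N,c≤
      δ = 1ℚ ℚ.- ρ
      ρ+δ≤1 : ρ ℚ.+ δ ℚ.≤ 1ℚ
      ρ+δ≤1 = ℚ.≤-reflexive (solve 1 (λ r → r :+ (con 1ℚ :- r) := con 1ℚ) refl ρ)

-- Gaussian rationals

infixl 6 _⊕_ _⊝_
infixl 7 _⊗_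
infix  8 ⊖_

record ℚ[i] : Set where
  constructor _,ᵢ_
  field
    Re Im : ℚ

open ℚ[i]

0ᵢ 1ᵢ : ℚ[i]
0ᵢ = 0ℚ ,ᵢ 0ℚ
1ᵢ = 1ℚ ,ᵢ 0ℚ

⊖_ : ℚ[i] → ℚ[i]
⊖ z = (ℚ.- Re z) ,ᵢ (ℚ.- Im z)

_⊕_ _⊝_ _⊗_ : ℚ[i] → ℚ[i] → ℚ[i]
z ⊕ w = (Re z ℚ.+ Re w) ,ᵢ (Im z ℚ.+ Im w)
z ⊝ w = z ⊕ ⊖ w
z ⊗ w = (Re z ℚ.* Re w ℚ.- Im z ℚ.* Im w) ,ᵢ (Re z ℚ.* Im w ℚ.+ Im z ℚ.* Re w)

norm : ℚ[i] → ℚ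
norm z = Re z ℚ.* Re z ℚ.+ Im z ℚ.* Im z

module _ where
  open +-*-Solver

  ⊗-assoc : ∀ x y z → (x ⊗ y) ⊗ z ≡ x ⊗ (y ⊗ z)
  ⊗-assoc (a ,ᵢ b) (c ,ᵢ d) (e ,ᵢ f) = cong₂ _,ᵢ_
    (solve 6 (λ a b c d e f →
       (a :* c :- b :* d) :* e :- (a :* d :+ b :* c) :* f
       := a :* (c :* e :- d :* f) :- b :* (c :* f :+ d :* e)) refl a b c d e f)
    (solve 6 (λ a b c d e f →
       (a :* c :- b :* d) :* f :+ (a :* d :+ b :* c) :* e
       := a :* (c :* f :+ d :* e) :+ b :* (c :* e :- d :* f)) refl a b c d e f)

  ⊗-comm : ∀ x y → x ⊗ y ≡ y ⊗ x
  ⊗-comm (a ,ᵢ b) (c ,ᵢ d) = cong₂ _,ᵢ_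
    (solve 4 (λ a b c d → a :* c :- b :* d := c :* a :- d :* b) refl a b c d)
    (solve 4 (λ a b c d → a :* d :+ b :* c := c :* b :+ d :* a) refl a b c d)

  ⊗-identityˡ : ∀ x → 1ᵢ ⊗ x ≡ x
  ⊗-identityˡ (a ,ᵢ b) = cong₂ _,ᵢ_
    (solve 2 (λ a b → con 1ℚ :* a :- con 0ℚ :* b := a) refl a b)
    (solve 2 (λ a b → con 1ℚ :* b :+ con 0ℚ :* a := b) refl a b)

  ⊗-distribˡ-⊕ : ∀ x y z → x ⊗ (y ⊕ z) ≡ x ⊗ y ⊕ x ⊗ z
  ⊗-distribˡ-⊕ (a ,ᵢ b) (c ,ᵢ d) (e ,ᵢ f) = cong₂ _,ᵢ_
    (solve 6 (λ a b c d e f → a :* (c :+ e) :- b :* (d :+ f)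
       := (a :* c :- b :* d) :+ (a :* e :- b :* f)) refl a b c d e f)
    (solve 6 (λ a b c d e f → a :* (d :+ f) :+ b :* (c :+ e)
       := (a :* d :+ b :* c) :+ (a :* f :+ b :* e)) refl a b c d e f)

  -- The two-square identity of Brahmagupta and Fibonacci.
  norm-⊗ : ∀ z w → norm (z ⊗ w) ≡ norm z ℚ.* norm w
  norm-⊗ (a ,ᵢ b) (c ,ᵢ d) = solve 4 (λ a b c d →
    (a :* c :- b :* d) :* (a :* c :- b :* d) :+ (a :* d :+ b :* c) :* (a :* d :+ b :* c)
    := (a :* a :+ b :* b) :* (c :* c :+ d :* d)) refl a b c d

  norm-⊖ : ∀ z → norm (⊖ z) ≡ norm z
  norm-⊖ (a ,ᵢ b) =
    solve 2 (λ a b → (:- a) :* (:- a) :+ (:- b) :* (:- b) := a :* a :+ b :* b) refl a b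

0≤norm : ∀ z → 0ℚ ℚ.≤ norm z
0≤norm z = 0≤+ (0≤x*x (Re z)) (0≤x*x (Im z))

ℚ[i]-commutativeRing : CommutativeRing _ _
ℚ[i]-commutativeRing = record
  { Carrier = ℚ[i] ; _≈_ = _≡_ ; _+_ = _⊕_ ; _*_ = _⊗_ ; -_ = ⊖_ ; 0# = 0ᵢ ; 1# = 1ᵢ
  ; isCommutativeRing = record
    { isRing = record
      { +-isAbelianGroup = record
        { isGroup = record
          { isMonoid = record
            { isSemigroup = record
              { isMagma = isMagma _⊕_
              ; assoc = λ x y z → cong₂ _,ᵢ_ (ℚ.+-assoc (Re x) (Re y) (Re z))
                                             (ℚ.+-assoc (Im x) (Im y) (Im z)) }
            ; identity = comm∧idˡ⇒id ⊕-comm λ x →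
                cong₂ _,ᵢ_ (ℚ.+-identityˡ (Re x)) (ℚ.+-identityˡ (Im x)) }
          ; inverse = comm∧invˡ⇒inv ⊕-comm λ x →
              cong₂ _,ᵢ_ (ℚ.+-inverseˡ (Re x)) (ℚ.+-inverseˡ (Im x))
          ; ⁻¹-cong = cong ⊖_ }
        ; comm = ⊕-comm }
      ; *-cong = cong₂ _⊗_
      ; *-assoc = ⊗-assoc
      ; *-identity = comm∧idˡ⇒id ⊗-comm ⊗-identityˡ
      ; distrib = ⊗-distribˡ-⊕ , comm∧distrˡ⇒distrʳ ⊗-comm ⊗-distribˡ-⊕ }
    ; *-comm = ⊗-comm } }
  where
  ⊕-comm : ∀ x y → x ⊕ y ≡ y ⊕ x
  ⊕-comm x y = cong₂ _,ᵢ_ (ℚ.+-comm (Re x) (Re y)) (ℚ.+-comm (Im x) (Im y))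

_≟ᵢ_ : DecidableEquality ℚ[i]
(a ,ᵢ b) ≟ᵢ (c ,ᵢ d) = map′ (λ (p , q) → cong₂ _,ᵢ_ p q)
  (λ p → cong Re p , cong Im p) (a ℚ.≟ c ×-dec b ℚ.≟ d)

module ℚ[i]-Solver =
  RingSolver (fromCommutativeRing ℚ[i]-commutativeRing) _≟ᵢ_

open Exp (CommutativeRing.commutativeSemiring ℚ[i]-commutativeRing)
  using () renaming (_^_ to _^ᵢ_; ^-homo-* to ^ᵢ-homo; ^-assocʳ to ^ᵢ-assocʳ)

-- Bounds on absolute values, with the square root cleared.

infix 4 ∣_∣≤_ _≤∣_∣

-- `norm` is the squared modulus, so the sign of r is recorded beside the squared inequality;
-- together they say |z| ≤ r.
record ∣_∣≤_ (z : ℚ[i]) (r : ℚ) : Set where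
  constructor upper
  field
    nonNeg : 0ℚ ℚ.≤ r
    norm≤  : norm z ℚ.≤ r ℚ.* r

record _≤∣_∣ (r : ℚ) (z : ℚ[i]) : Set where
  constructor lower
  field
    nonNeg : 0ℚ ℚ.≤ r
    ≤norm  : r ℚ.* r ℚ.≤ norm z

module _ where
  open +-*-Solver
  open ℚ.≤-Reasoning

  ∣1∣≤1 : ∣ 1ᵢ ∣≤ 1ℚ
  ∣1∣≤1 = upper 0≤1 ℚ.≤-refl

  ∣0∣≤0 : ∣ 0ᵢ ∣≤ 0ℚ
  ∣0∣≤0 = upper ℚ.≤-refl ℚ.≤-refl

  1≤∣1∣ : 1ℚ ≤∣ 1ᵢ ∣
  1≤∣1∣ = lower 0≤1 ℚ.≤-refl

  ∣∣≤-trans : ∀ {z r s} → ∣ z ∣≤ r → r ℚ.≤ s → ∣ z ∣≤ s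
  ∣∣≤-trans (upper 0≤r z≤r) r≤s =
    upper 0≤s (ℚ.≤-trans z≤r (*-mono-≤ 0≤s 0≤r r≤s r≤s))
    where 0≤s = ℚ.≤-trans 0≤r r≤s

  ≤∣∣-trans : ∀ {z r s} → 0ℚ ℚ.≤ r → r ℚ.≤ s → s ≤∣ z ∣ → r ≤∣ z ∣
  ≤∣∣-trans 0≤r r≤s (lower 0≤s s≤z) =
    lower 0≤r (ℚ.≤-trans (*-mono-≤ 0≤s 0≤r r≤s r≤s) s≤z)

  ∣⊖∣≤ : ∀ {z r} → ∣ z ∣≤ r → ∣ ⊖ z ∣≤ r
  ∣⊖∣≤ {z} {r} (upper 0≤r z≤r) = upper 0≤r (subst (ℚ._≤ r ℚ.* r) (sym (norm-⊖ z)) z≤r)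

  private
    *-interchange : ∀ r s → (r ℚ.* r) ℚ.* (s ℚ.* s) ≡ (r ℚ.* s) ℚ.* (r ℚ.* s)
    *-interchange = solve 2 (λ r s → (r :* r) :* (s :* s) := (r :* s) :* (r :* s)) refl

  ∣⊗∣≤ : ∀ {z w r s} → ∣ z ∣≤ r → ∣ w ∣≤ s → ∣ z ⊗ w ∣≤ r ℚ.* s
  ∣⊗∣≤ {z} {w} {r} {s} (upper 0≤r z≤r) (upper 0≤s w≤s) = upper (0≤* 0≤r 0≤s)
    (subst₂ ℚ._≤_ (sym (norm-⊗ z w)) (*-interchange r s)
      (*-mono-≤ (0≤* 0≤r 0≤r) (0≤norm w) z≤r w≤s))

  ≤∣⊗∣ : ∀ {z w r s} → r ≤∣ z ∣ → s ≤∣ w ∣ → r ℚ.* s ≤∣ z ⊗ w ∣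
  ≤∣⊗∣ {z} {w} {r} {s} (lower 0≤r r≤z) (lower 0≤s s≤w) = lower (0≤* 0≤r 0≤s)
    (subst₂ ℚ._≤_ (*-interchange r s) (sym (norm-⊗ z w))
      (*-mono-≤ (0≤norm z) (0≤* 0≤s 0≤s) r≤z s≤w))

  ∣⊕∣≤ : ∀ {z w r s} → ∣ z ∣≤ r → ∣ w ∣≤ s → ∣ z ⊕ w ∣≤ r ℚ.+ s
  ∣⊕∣≤ {z@(a ,ᵢ b)} {w@(c ,ᵢ d)} {r} {s} (upper 0≤r z≤r) (upper 0≤s w≤s) =
    upper (0≤+ 0≤r 0≤s) (begin
      norm (z ⊕ w)
        ≡⟨ solve 4 (λ a b c d →
             (a :+ c) :* (a :+ c) :+ (b :+ d) :* (b :+ d)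
             := ((a :* a :+ b :* b) :+ (c :* c :+ d :* d))
                :+ ((a :* c :+ b :* d) :+ (a :* c :+ b :* d))) refl a b c d ⟩
      (norm z ℚ.+ norm w) ℚ.+ (t ℚ.+ t)
        ≤⟨ ℚ.+-mono-≤ (ℚ.+-mono-≤ z≤r w≤s) (ℚ.+-mono-≤ t≤rs t≤rs) ⟩
      (r ℚ.* r ℚ.+ s ℚ.* s) ℚ.+ (r ℚ.* s ℚ.+ r ℚ.* s)
        ≡⟨ solve 2 (λ r s → (r :* r :+ s :* s) :+ (r :* s :+ r :* s)
             := (r :+ s) :* (r :+ s)) refl r s ⟩
      (r ℚ.+ s) ℚ.* (r ℚ.+ s) ∎)
    where
    t = a ℚ.* c ℚ.+ b ℚ.* d
    -- The defect in the inequality below: by Lagrange's identity t² + x² = |z|² |w|².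
    x = a ℚ.* d ℚ.- b ℚ.* c
    -- Cauchy–Schwarz
    t≤rs : t ℚ.≤ r ℚ.* s
    t≤rs = x*x-cancel-≤ (0≤* 0≤r 0≤s) (begin
      t ℚ.* t
        ≤⟨ ≤-by (x ℚ.* x) (0≤x*x x) (solve 4 (λ a b c d →
             (a :* c :+ b :* d) :* (a :* c :+ b :* d)
             :+ (a :* d :- b :* c) :* (a :* d :- b :* c)
             := (a :* a :+ b :* b) :* (c :* c :+ d :* d)) refl a b c d) ⟩
      norm z ℚ.* norm w
        ≤⟨ *-mono-≤ (0≤* 0≤r 0≤r) (0≤norm w) z≤r w≤s ⟩
      (r ℚ.* r) ℚ.* (s ℚ.* s)
        ≡⟨ *-interchange r s ⟩
      (r ℚ.* s) ℚ.* (r ℚ.* s) ∎)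

  ∣^∣≤ : ∀ {z r} → ∣ z ∣≤ r → ∀ n → ∣ z ^ᵢ n ∣≤ r ^ℚ n
  ∣^∣≤ z≤r zero    = ∣1∣≤1
  ∣^∣≤ z≤r (suc n) = ∣⊗∣≤ z≤r (∣^∣≤ z≤r n)

  ∣Re∣≤ : ∀ {z r} → ∣ z ∣≤ r → ℚ.∣ Re z ∣ ℚ.≤ r
  ∣Re∣≤ {z} (upper 0≤r z≤r) = x*x≤r*r⇒∣x∣≤r 0≤r
    (ℚ.≤-trans (≤-by _ (0≤x*x (Im z)) refl) z≤r)

  ∣Im∣≤ : ∀ {z r} → ∣ z ∣≤ r → ℚ.∣ Im z ∣ ℚ.≤ r
  ∣Im∣≤ {z} (upper 0≤r z≤r) = x*x≤r*r⇒∣x∣≤r 0≤r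
    (ℚ.≤-trans (≤-by _ (0≤x*x (Re z)) (ℚ.+-comm (Im z ℚ.* Im z) (Re z ℚ.* Re z))) z≤r)

  -- The real part alone suffices: |1 - z| ≥ 1 - Re z ≥ 1 - r.
  ≤∣1⊝∣ : ∀ {z r} → r ℚ.≤ 1ℚ → ∣ z ∣≤ r → 1ℚ ℚ.- r ≤∣ 1ᵢ ⊝ z ∣
  ≤∣1⊝∣ {z@(a ,ᵢ b)} {r} r≤1 z≤r = lower 0≤1-r (begin
    (1ℚ ℚ.- r) ℚ.* (1ℚ ℚ.- r)
      ≤⟨ *-mono-≤ (ℚ.≤-trans 0≤1-r 1-r≤1-a) 0≤1-r 1-r≤1-a 1-r≤1-a ⟩
    (1ℚ ℚ.- a) ℚ.* (1ℚ ℚ.- a)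
      ≤⟨ ≤-by (y ℚ.* y) (0≤x*x y) refl ⟩
    norm (1ᵢ ⊝ z) ∎)
    where
    y = 0ℚ ℚ.- b
    0≤1-r = x≤y⇒0≤y-x r≤1
    1-r≤1-a = ℚ.+-monoʳ-≤ 1ℚ (ℚ.neg-antimono-≤ (ℚ.≤-trans (x≤∣x∣ a) (∣Re∣≤ z≤r)))

  -- Division by w without forming a quotient: |w|² |z|² ≤ s² r² while s² ≤ |w|². It will remove the
  -- factor 1 - q from the final estimate.
  ∣∣≤-cancel : ∀ {z w r s} → 0ℚ ℚ.< s → s ≤∣ w ∣ → ∣ w ⊗ z ∣≤ s ℚ.* r → 0ℚ ℚ.≤ r → ∣ z ∣≤ r
  ∣∣≤-cancel {z} {w} {r} {s} 0<s (lower _ s≤w) (upper _ wz≤sr) 0≤r = upper 0≤r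
    (ℚ.*-cancelˡ-≤-pos (s ℚ.* s) {{ℚ.positive (0<* 0<s 0<s)}} (begin
      (s ℚ.* s) ℚ.* norm z    ≤⟨ ℚ.*-monoʳ-≤-nonNeg (norm z) {{ℚ.nonNegative (0≤norm z)}} s≤w ⟩
      norm w ℚ.* norm z       ≡⟨ norm-⊗ w z ⟨
      norm (w ⊗ z)            ≤⟨ wz≤sr ⟩
      (s ℚ.* r) ℚ.* (s ℚ.* r) ≡⟨ *-interchange s r ⟨
      (s ℚ.* s) ℚ.* (r ℚ.* r) ∎))

-- Finite q-Pochhammer symbols

pochᵢ : (a Q : ℚ[i]) → ℕ → ℚ[i]
pochᵢ a Q zero    = 1ᵢ
pochᵢ a Q (suc n) = pochᵢ a Q n ⊗ (1ᵢ ⊝ a ⊗ Q ^ᵢ n)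

module _ where
  open ℚ[i]-Solver
  open ≡-Reasoning

  -- Both sides are the product with n + 1 factors, once with its first and once with its last
  -- factor split off.
  pochᵢ-shift : ∀ a Q n → (1ᵢ ⊝ a) ⊗ pochᵢ (a ⊗ Q) Q n ≡ pochᵢ a Q n ⊗ (1ᵢ ⊝ a ⊗ Q ^ᵢ n)
  pochᵢ-shift a Q zero    =
    solve 1 (λ a → (con 1ᵢ :- a) :* con 1ᵢ := con 1ᵢ :* (con 1ᵢ :- a :* con 1ᵢ)) refl a
  pochᵢ-shift a Q (suc n) = begin
    (1ᵢ ⊝ a) ⊗ (pochᵢ (a ⊗ Q) Q n ⊗ (1ᵢ ⊝ (a ⊗ Q) ⊗ Q ^ᵢ n))
      ≡⟨ ⊗-assoc (1ᵢ ⊝ a) (pochᵢ (a ⊗ Q) Q n) _ ⟨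
    (1ᵢ ⊝ a) ⊗ pochᵢ (a ⊗ Q) Q n ⊗ (1ᵢ ⊝ (a ⊗ Q) ⊗ Q ^ᵢ n)
      ≡⟨ cong₂ (λ x y → x ⊗ (1ᵢ ⊝ y)) (pochᵢ-shift a Q n) (⊗-assoc a Q (Q ^ᵢ n)) ⟩
    pochᵢ a Q (suc n) ⊗ (1ᵢ ⊝ a ⊗ Q ^ᵢ suc n) ∎

-- Bounds on the finite products, uniform in the number of factors.

module _ {ρ} (0≤ρ : 0ℚ ℚ.≤ ρ) (ρ<1 : ρ ℚ.< 1ℚ) where
  open +-*-Solver
  open ℚ.≤-Reasoning

  private
    δ = 1ℚ ℚ.- ρ
    0≤δ : 0ℚ ℚ.≤ δ
    0≤δ = ℚ.<⇒≤ (0<1-x ρ<1)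
    ρ≤1 = ℚ.<⇒≤ ρ<1

    -- An exponent making t ↦ (1 - t)ᵐ decay fast enough for one-step-bound.
    m,1≤mδ : ∃ λ m → 1ℚ ℚ.≤ ι m ℚ.* δ
    m,1≤mδ = archimedean* (0<1-x ρ<1) 1ℚ
    m = proj₁ m,1≤mδ
    1≤mδ = proj₂ m,1≤mδ

    one-step-bound : ∀ {t} → 0ℚ ℚ.≤ t → t ℚ.≤ 1ℚ →
      (1ℚ ℚ.- t) ^ℚ m ℚ.≤ (1ℚ ℚ.- t) ℚ.* (1ℚ ℚ.- ρ ℚ.* t) ^ℚ m
    one-step-bound {t} 0≤t t≤1 = begin
      x ^ℚ m                            ≡⟨ ℚ.*-identityˡ (x ^ℚ m) ⟨
      1ℚ ℚ.* x ^ℚ m                     ≤⟨ ℚ.*-monoʳ-≤-nonNeg (x ^ℚ m) {{ℚ.nonNegative (0≤^ 0≤x m)}} 1≤ ⟩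
      (x ℚ.+ ι m ℚ.* y) ℚ.* x ^ℚ m      ≤⟨ bernoulli 0≤x (0≤* 0≤δ 0≤t) m ⟩
      (x ℚ.+ y) ^ℚ m ℚ.* x              ≡⟨ cong (λ z → z ^ℚ m ℚ.* x) x+y≡ ⟩
      (1ℚ ℚ.- ρ ℚ.* t) ^ℚ m ℚ.* x       ≡⟨ ℚ.*-comm _ x ⟩
      x ℚ.* (1ℚ ℚ.- ρ ℚ.* t) ^ℚ m       ∎
      where
      x = 1ℚ ℚ.- t
      y = δ ℚ.* t
      0≤x = x≤y⇒0≤y-x t≤1
      x+y≡ : x ℚ.+ y ≡ 1ℚ ℚ.- ρ ℚ.* t
      x+y≡ = solve 2 (λ t r → con 1ℚ :- t :+ (con 1ℚ :- r) :* t := con 1ℚ :- r :* t) refl t ρ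
      1≤ : 1ℚ ℚ.≤ x ℚ.+ ι m ℚ.* y
      1≤ = ≤-by ((ι m ℚ.* δ ℚ.- 1ℚ) ℚ.* t) (0≤* (x≤y⇒0≤y-x 1≤mδ) 0≤t)
        (solve 3 (λ t d k → con 1ℚ :+ (k :* d :- con 1ℚ) :* t
                   := con 1ℚ :- t :+ k :* (d :* t)) refl t δ (ι m))

    -- The real products (α;ρ)ₙ and (-α;ρ)ₙ, which bound |(a;Q)ₙ| below and above when |a| ≤ α and
    -- |Q| ≤ ρ.
    ∏1- ∏1+ : ℚ → ℕ → ℚ
    ∏1- α zero    = 1ℚ
    ∏1- α (suc n) = ∏1- α n ℚ.* (1ℚ ℚ.- α ℚ.* ρ ^ℚ n)
    ∏1+ α zero    = 1ℚ
    ∏1+ α (suc n) = ∏1+ α n ℚ.* (1ℚ ℚ.+ α ℚ.* ρ ^ℚ n)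

    c,C : ∃ λ C → 0ℚ ℚ.< C × δ ^ℚ m ℚ.* C ≡ 1ℚ
    c,C = inverse (0<^ (0<1-x ρ<1) m)
    c = δ ^ℚ m

  pochᵢ-lower : ℚ
  pochᵢ-lower = c

  0<pochᵢ-lower : 0ℚ ℚ.< pochᵢ-lower
  0<pochᵢ-lower = 0<^ (0<1-x ρ<1) m

  pochᵢ-upper : ℚ
  pochᵢ-upper = proj₁ c,C

  0≤pochᵢ-upper : 0ℚ ℚ.≤ pochᵢ-upper
  0≤pochᵢ-upper = ℚ.<⇒≤ (proj₁ (proj₂ c,C))

  -- The tail of the geometric series from ρⁿ on is ρⁿ / (1 - ρ) ≤ m ρⁿ, and each factor changes a
  -- product bounded by `pochᵢ-upper`; hence the product of these two constants.
  pochᵢ-modulus : ℚ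
  pochᵢ-modulus = ι m ℚ.* pochᵢ-upper

  0≤pochᵢ-modulus : 0ℚ ℚ.≤ pochᵢ-modulus
  0≤pochᵢ-modulus = 0≤* (0≤ι m) 0≤pochᵢ-upper

  module _ {α} (0≤α : 0ℚ ℚ.≤ α) (α≤ρ : α ℚ.≤ ρ) where
    private
      0≤t : ∀ n → 0ℚ ℚ.≤ α ℚ.* ρ ^ℚ n
      0≤t n = 0≤* 0≤α (0≤^ 0≤ρ n)

      t≤1 : ∀ n → α ℚ.* ρ ^ℚ n ℚ.≤ 1ℚ
      t≤1 n = *-mono-≤ 0≤1 (0≤^ 0≤ρ n) (ℚ.≤-trans α≤ρ ρ≤1) (^≤1 0≤ρ ρ≤1 n)

      0≤1-t : ∀ n → 0ℚ ℚ.≤ 1ℚ ℚ.- α ℚ.* ρ ^ℚ n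
      0≤1-t n = x≤y⇒0≤y-x (t≤1 n)

      1-t≤1 : ∀ n → 1ℚ ℚ.- α ℚ.* ρ ^ℚ n ℚ.≤ 1ℚ
      1-t≤1 n = ≤-by _ (0≤t n)
        (solve 1 (λ t → con 1ℚ :- t :+ t := con 1ℚ) refl (α ℚ.* ρ ^ℚ n))

      0≤∏1- : ∀ n → 0ℚ ℚ.≤ ∏1- α n
      0≤∏1- zero    = 0≤1
      0≤∏1- (suc n) = 0≤* (0≤∏1- n) (0≤1-t n)

      0≤∏1+ : ∀ n → 0ℚ ℚ.≤ ∏1+ α n
      0≤∏1+ zero    = 0≤1
      0≤∏1+ (suc n) = 0≤* (0≤∏1+ n) (0≤+ 0≤1 (0≤t n))

      -- The right side equals (1 - α)ᵐ at n = 0 and never decreases: `one-step-bound` at t = α ρⁿ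
      -- pays for the new factor 1 - t by passing from t to ρ t in the m-th power.
      ∏1--invariant : ∀ n →
        (1ℚ ℚ.- α) ^ℚ m ℚ.≤ ∏1- α n ℚ.* (1ℚ ℚ.- α ℚ.* ρ ^ℚ n) ^ℚ m
      ∏1--invariant zero    = ℚ.≤-reflexive (trans
        (cong (λ x → (1ℚ ℚ.- x) ^ℚ m) (sym (ℚ.*-identityʳ α)))
        (sym (ℚ.*-identityˡ ((1ℚ ℚ.- α ℚ.* 1ℚ) ^ℚ m))))
      ∏1--invariant (suc n) = begin
        (1ℚ ℚ.- α) ^ℚ m
          ≤⟨ ∏1--invariant n ⟩
        L ℚ.* (1ℚ ℚ.- t) ^ℚ m
          ≤⟨ ℚ.*-monoˡ-≤-nonNeg L {{ℚ.nonNegative (0≤∏1- n)}} (one-step-bound (0≤t n) (t≤1 n)) ⟩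
        L ℚ.* ((1ℚ ℚ.- t) ℚ.* (1ℚ ℚ.- ρ ℚ.* t) ^ℚ m)
          ≡⟨ ℚ.*-assoc L (1ℚ ℚ.- t) ((1ℚ ℚ.- ρ ℚ.* t) ^ℚ m) ⟨
        L ℚ.* (1ℚ ℚ.- t) ℚ.* (1ℚ ℚ.- ρ ℚ.* t) ^ℚ m
          ≡⟨ cong (λ x → L ℚ.* (1ℚ ℚ.- t) ℚ.* (1ℚ ℚ.- x) ^ℚ m)
               (solve 3 (λ r a p → r :* (a :* p) := a :* (r :* p)) refl ρ α (ρ ^ℚ n)) ⟩
        ∏1- α (suc n) ℚ.* (1ℚ ℚ.- α ℚ.* ρ ^ℚ suc n) ^ℚ m ∎
        where
        L = ∏1- α n
        t = α ℚ.* ρ ^ℚ n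

      c≤∏1- : ∀ n → c ℚ.≤ ∏1- α n
      c≤∏1- n = begin
        δ ^ℚ m
          ≤⟨ ^-monoˡ-≤ 0≤δ (ℚ.+-monoʳ-≤ 1ℚ (ℚ.neg-antimono-≤ α≤ρ)) m ⟩
        (1ℚ ℚ.- α) ^ℚ m
          ≤⟨ ∏1--invariant n ⟩
        ∏1- α n ℚ.* (1ℚ ℚ.- α ℚ.* ρ ^ℚ n) ^ℚ m
          ≤⟨ ℚ.*-monoˡ-≤-nonNeg (∏1- α n) {{ℚ.nonNegative (0≤∏1- n)}} (^≤1 (0≤1-t n) (1-t≤1 n) m) ⟩
        ∏1- α n ℚ.* 1ℚ
          ≡⟨ ℚ.*-identityʳ (∏1- α n) ⟩
        ∏1- α n ∎

      ∏1+*∏1-≤1 : ∀ n → ∏1+ α n ℚ.* ∏1- α n ℚ.≤ 1ℚ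
      ∏1+*∏1-≤1 zero    = ℚ.≤-refl
      ∏1+*∏1-≤1 (suc n) = begin
        U ℚ.* (1ℚ ℚ.+ t) ℚ.* (L ℚ.* (1ℚ ℚ.- t))
          ≤⟨ ≤-by (U ℚ.* L ℚ.* (t ℚ.* t)) (0≤* (0≤* (0≤∏1+ n) (0≤∏1- n)) (0≤x*x t))
               (solve 3 (λ u l t → u :* (con 1ℚ :+ t) :* (l :* (con 1ℚ :- t)) :+ u :* l :* (t :* t)
                          := u :* l) refl U L t) ⟩
        U ℚ.* L
          ≤⟨ ∏1+*∏1-≤1 n ⟩
        1ℚ ∎
        where
        U = ∏1+ α n
        L = ∏1- α n
        t = α ℚ.* ρ ^ℚ n

      ∏1+≤C : ∀ n → ∏1+ α n ℚ.≤ pochᵢ-upper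
      ∏1+≤C n = begin
        U                            ≡⟨ ℚ.*-identityʳ U ⟨
        U ℚ.* 1ℚ                     ≡⟨ cong (U ℚ.*_) (proj₂ (proj₂ c,C)) ⟨
        U ℚ.* (c ℚ.* C)              ≡⟨ ℚ.*-assoc U c C ⟨
        U ℚ.* c ℚ.* C                ≤⟨ ℚ.*-monoʳ-≤-nonNeg C {{ℚ.nonNegative 0≤pochᵢ-upper}}
                                          (ℚ.*-monoˡ-≤-nonNeg U {{ℚ.nonNegative (0≤∏1+ n)}} (c≤∏1- n)) ⟩
        U ℚ.* ∏1- α n ℚ.* C          ≤⟨ ℚ.*-monoʳ-≤-nonNeg C {{ℚ.nonNegative 0≤pochᵢ-upper}} (∏1+*∏1-≤1 n) ⟩
        1ℚ ℚ.* C                     ≡⟨ ℚ.*-identityˡ C ⟩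
        C                            ∎
        where
        U = ∏1+ α n
        C = pochᵢ-upper

    module _ {a Q} (a≤α : ∣ a ∣≤ α) (Q≤ρ : ∣ Q ∣≤ ρ) where
      private
        C = pochᵢ-upper
        D = pochᵢ-modulus
        P = pochᵢ a Q

        aQⁿ≤ : ∀ n → ∣ a ⊗ Q ^ᵢ n ∣≤ α ℚ.* ρ ^ℚ n
        aQⁿ≤ n = ∣⊗∣≤ a≤α (∣^∣≤ Q≤ρ n)

        ∏1-≤P : ∀ n → ∏1- α n ≤∣ P n ∣
        ∏1-≤P zero    = 1≤∣1∣
        ∏1-≤P (suc n) = ≤∣⊗∣ (∏1-≤P n) (≤∣1⊝∣ (t≤1 n) (aQⁿ≤ n))

        P≤∏1+ : ∀ n → ∣ P n ∣≤ ∏1+ α n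
        P≤∏1+ zero    = ∣1∣≤1
        P≤∏1+ (suc n) = ∣⊗∣≤ (P≤∏1+ n) (∣⊕∣≤ ∣1∣≤1 (∣⊖∣≤ (aQⁿ≤ n)))

      pochᵢ≥lower : ∀ n → pochᵢ-lower ≤∣ P n ∣
      pochᵢ≥lower n = ≤∣∣-trans (ℚ.<⇒≤ 0<pochᵢ-lower) (c≤∏1- n) (∏1-≤P n)

      pochᵢ≤upper : ∀ n → ∣ P n ∣≤ pochᵢ-upper
      pochᵢ≤upper n = ∣∣≤-trans (P≤∏1+ n) (∏1+≤C n)

      private
        -- The subtracted power lets the induction close. With r = ρ^(d+n), one more factor changes
        -- the product by at most C α r, while the bound grows by D α (1 - ρ) r; this is at least as
        -- much, since D = m C and m (1 - ρ) ≥ 1.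
        difference-bound : ∀ n d →
          ∣ P (d ℕ.+ n) ⊝ P n ∣≤ D ℚ.* α ℚ.* (ρ ^ℚ n ℚ.- ρ ^ℚ (d ℕ.+ n))
        difference-bound n zero    = subst₂ ∣_∣≤_
          (sym (CommutativeRing.-‿inverseʳ ℚ[i]-commutativeRing (P n)))
          (solve 3 (λ d a r → con 0ℚ := d :* a :* (r :- r)) refl D α (ρ ^ℚ n))
          ∣0∣≤0
        difference-bound n (suc d) = ∣∣≤-trans
          (subst (∣_∣≤ (C ℚ.* (α ℚ.* r) ℚ.+ D ℚ.* α ℚ.* (s ℚ.- r))) regroup
            (∣⊕∣≤ (∣⊗∣≤ (pochᵢ≤upper (d ℕ.+ n)) (∣⊖∣≤ (aQⁿ≤ (d ℕ.+ n)))) (difference-bound n d)))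
          (≤-by (C ℚ.* (α ℚ.* r) ℚ.* (ι m ℚ.* δ ℚ.- 1ℚ))
            (0≤* (0≤* 0≤pochᵢ-upper (0≤t (d ℕ.+ n))) (x≤y⇒0≤y-x 1≤mδ))
            (solve 6 (λ c a r s k ρ →
               (c :* (a :* r) :+ (k :* c) :* a :* (s :- r))
               :+ c :* (a :* r) :* (k :* (con 1ℚ :- ρ) :- con 1ℚ)
               := (k :* c) :* a :* (s :- ρ :* r)) refl C α r s (ι m) ρ))
          where
          r = ρ ^ℚ (d ℕ.+ n)
          s = ρ ^ℚ n
          regroup : P (d ℕ.+ n) ⊗ (⊖ (a ⊗ Q ^ᵢ (d ℕ.+ n))) ⊕ (P (d ℕ.+ n) ⊝ P n)
                    ≡ P (suc d ℕ.+ n) ⊝ P n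
          regroup = S.solve 3 (λ p t q → p S.:* (S.:- t) S.:+ (p S.:- q)
              S.:= p S.:* (S.con 1ᵢ S.:- t) S.:- q) refl (P (d ℕ.+ n)) (a ⊗ Q ^ᵢ (d ℕ.+ n)) (P n)
            where module S = ℚ[i]-Solver

      -- The factor α is retained so that a small a forces the product near 1: this is the case n =
      -- 0, used in `product≈`.
      pochᵢ-cauchy : ∀ {n k} → n ℕ.≤ k → ∣ P k ⊝ P n ∣≤ pochᵢ-modulus ℚ.* α ℚ.* ρ ^ℚ n
      pochᵢ-cauchy {n} {k} n≤k = ∣∣≤-trans
        (subst (λ j → ∣ P j ⊝ P n ∣≤ D ℚ.* α ℚ.* (ρ ^ℚ n ℚ.- ρ ^ℚ j)) (ℕ.m∸n+n≡m n≤k)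
          (difference-bound n (k ℕ.∸ n)))
        (≤-by (D ℚ.* α ℚ.* ρ ^ℚ k) (0≤* (0≤* 0≤pochᵢ-modulus 0≤α) (0≤^ 0≤ρ k))
          (solve 3 (λ d s r → d :* (s :- r) :+ d :* r := d :* s) refl (D ℚ.* α) (ρ ^ℚ n) (ρ ^ℚ k)))

-- Complex limits

-- Sums, products and negatives of complex numbers are formed entrywise, so `at` commutes with them
-- definitionally and identities can be checked among Gaussian rationals.
at : ℂ → ℕ → ℚ[i]
at z k = seq (re z) k ,ᵢ seq (im z) k

at-^ : ∀ z n k → at (z ^ n) k ≡ at z k ^ᵢ n
at-^ z zero    k = refl
at-^ z (suc n) k = cong (at z k ⊗_) (at-^ z n k)

at-poch : ∀ a q n k → at (poch a q n) k ≡ pochᵢ (at a k) (at q k) n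
at-poch a q zero    k = refl
at-poch a q (suc n) k =
  cong₂ (λ p x → p ⊗ (1ᵢ ⊝ at a k ⊗ x)) (at-poch a q n k) (at-^ q n k)

∣⊝∣≤-swap : ∀ z w {r} → ∣ z ⊝ w ∣≤ r → ∣ w ⊝ z ∣≤ r
∣⊝∣≤-swap z w z-w≤r = subst (∣_∣≤ _)
  (solve 2 (λ z w → :- (z :- w) := w :- z) refl z w) (∣⊖∣≤ z-w≤r)
  where open ℚ[i]-Solver

module _ where
  open +-*-Solver
  open ℚ.≤-Reasoning

  -- One N bounds both the index of the sequence and the index of the approximation, so the diagonal
  -- n = k is covered.
  UniformlyCauchyᵣ : (ℕ → ℝ) → Set
  UniformlyCauchyᵣ f = ∀ e → 0ℚ ℚ.< e →
    ∃ λ N → ∀ n k → N ℕ.≤ n → N ℕ.≤ k → ℚ.∣ seq (f n) k ℚ.- seq (f N) k ∣ ℚ.≤ e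

  UniformlyCauchy : (ℕ → ℂ) → Set
  UniformlyCauchy f = ∀ e → 0ℚ ℚ.< e →
    ∃ λ N → ∀ n k → N ℕ.≤ n → N ℕ.≤ k → ∣ at (f n) k ⊝ at (f N) k ∣≤ e

  diagonal-cauchy : ∀ f → UniformlyCauchyᵣ f → Cauchy (λ k → seq (f k) k)
  diagonal-cauchy f uc ε 0<ε = N ℕ.⊔ M , λ k l k≥ l≥ →
    let N≤k = ℕ.m⊔n≤o⇒m≤o N M k≥
        N≤l = ℕ.m⊔n≤o⇒m≤o N M l≥
        x   = seq (f k) k
        y   = seq (f N) k
        z   = seq (f N) l
        w   = seq (f l) l
    in begin-strict
      ℚ.∣ x ℚ.- w ∣
        -- The detour from one diagonal entry to another goes through the fixed real `f N`: its own
        -- Cauchy property costs ε/2, and reaching and leaving it cost ε/4 each.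
        ≡⟨ cong ℚ.∣_∣ (solve 4 (λ x y z w → x :- w := (x :- y) :+ ((y :- z) :- (w :- z)))
             refl x y z w) ⟩
      ℚ.∣ (x ℚ.- y) ℚ.+ ((y ℚ.- z) ℚ.- (w ℚ.- z)) ∣
        ≤⟨ ℚ.∣p+q∣≤∣p∣+∣q∣ (x ℚ.- y) _ ⟩
      ℚ.∣ x ℚ.- y ∣ ℚ.+ ℚ.∣ (y ℚ.- z) ℚ.- (w ℚ.- z) ∣
        ≤⟨ ℚ.+-monoʳ-≤ ℚ.∣ x ℚ.- y ∣ (ℚ.∣p-q∣≤∣p∣+∣q∣ (y ℚ.- z) (w ℚ.- z)) ⟩
      ℚ.∣ x ℚ.- y ∣ ℚ.+ (ℚ.∣ y ℚ.- z ∣ ℚ.+ ℚ.∣ w ℚ.- z ∣)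
        <⟨ ℚ.+-mono-≤-< (close k k N≤k N≤k) (ℚ.+-mono-<-≤
             (proj₂ M,cauchy k l (ℕ.m⊔n≤o⇒n≤o N M k≥) (ℕ.m⊔n≤o⇒n≤o N M l≥))
             (close l l N≤l N≤l)) ⟩
      ½ ℚ.* (½ ℚ.* ε) ℚ.+ (½ ℚ.* ε ℚ.+ ½ ℚ.* (½ ℚ.* ε))
        ≡⟨ solve 1 (λ e → con ½ :* (con ½ :* e) :+ (con ½ :* e :+ con ½ :* (con ½ :* e)) := e)
             refl ε ⟩
      ε ∎
    where
    N,close = uc (½ ℚ.* (½ ℚ.* ε)) (0<½* (0<½* 0<ε))
    N = proj₁ N,close
    close = proj₂ N,close
    M,cauchy = cauchy (f N) (½ ℚ.* ε) (0<½* 0<ε)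
    M = proj₁ M,cauchy

  diagonal : (f : ℕ → ℂ) → UniformlyCauchy f → ℂ
  diagonal f uc =
    mkℝ (λ k → seq (re (f k)) k) (diagonal-cauchy (λ n → re (f n)) λ e 0<e →
      proj₁ (uc e 0<e) , λ n k n≥ k≥ → ∣Re∣≤ (proj₂ (uc e 0<e) n k n≥ k≥))
    +i
    mkℝ (λ k → seq (im (f k)) k) (diagonal-cauchy (λ n → im (f n)) λ e 0<e →
      proj₁ (uc e 0<e) , λ n k n≥ k≥ → ∣Im∣≤ (proj₂ (uc e 0<e) n k n≥ k≥))

  ⟶-intro : ∀ f L → (∀ e → 0ℚ ℚ.< e → ∃ λ N → ∀ n → N ℕ.≤ n →
    ∃ λ K → ∀ k → K ℕ.≤ k → ∣ at (f n) k ⊝ at L k ∣≤ e) → f ⟶ L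
  ⟶-intro f L close ε 0<ε@(e , 0<e , M , e≤ε) =
    proj₁ (close h 0<h) , λ n n≥ →
      let K = proj₁ (proj₂ (close h 0<h) n n≥)
      in 0<ε , h ℚ.* h , 0<* 0<h 0<h , K ℕ.⊔ M , λ k k≥ →
        let e≤εk = ℚ.≤-trans (ℚ.≤-reflexive (sym (ℚ.+-identityˡ e))) (e≤ε k (ℕ.m⊔n≤o⇒n≤o K M k≥))
            0≤e  = ℚ.<⇒≤ 0<e
        in begin
          norm (at (f n) k ⊝ at L k) ℚ.+ h ℚ.* h
            ≤⟨ ℚ.+-monoˡ-≤ (h ℚ.* h)
                 (∣_∣≤_.norm≤ (proj₂ (proj₂ (close h 0<h) n n≥) k (ℕ.m⊔n≤o⇒m≤o K M k≥))) ⟩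
          h ℚ.* h ℚ.+ h ℚ.* h
            ≤⟨ ≤-by (h ℚ.* h ℚ.+ h ℚ.* h) (0≤+ (0≤x*x h) (0≤x*x h))
                 (solve 1 (λ e → let h = con ½ :* e in
                    (h :* h :+ h :* h) :+ (h :* h :+ h :* h) := e :* e) refl e) ⟩
          e ℚ.* e
            ≤⟨ *-mono-≤ (ℚ.≤-trans 0≤e e≤εk) 0≤e e≤εk e≤εk ⟩
          seq ε k ℚ.* seq ε k ∎
    where
    -- Since 2 h² ≤ e², one h² bounds the squared distance and the other is the uniform gap that
    -- `_<ᵣ_` demands.
    h = ½ ℚ.* e
    0<h = 0<½* 0<e

  #0-intro : ∀ {z c} K → 0ℚ ℚ.< c → (∀ k → K ℕ.≤ k → c ≤∣ at z k ∣) → z #0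
  #0-intro {z} {c} K 0<c c≤ = c ℚ.* c , 0<* 0<c 0<c , K , λ k k≥ →
    subst (ℚ._≤ norm (at z k)) (sym (ℚ.+-identityˡ (c ℚ.* c))) (_≤∣_∣.≤norm (c≤ k k≥))

  ∣∣<1⇒radius : ∀ {q} → ∣ q ∣< 1ℝ → ∃ λ ρ → 0ℚ ℚ.≤ ρ × ρ ℚ.< 1ℚ ×
    (∃ λ K → ∀ k → K ℕ.≤ k → ∣ at q k ∣≤ ρ)
  ∣∣<1⇒radius {q} (_ , ε , 0<ε , K , gap) = ρ , 0≤ρ , ρ<1 , K , λ k k≥ → upper 0≤ρ
      (≤-by ((1ℚ ℚ.* 1ℚ ℚ.- (norm (at q k) ℚ.+ ε)) ℚ.+ h ℚ.* h)
        (0≤+ (x≤y⇒0≤y-x (gap k k≥)) (0≤x*x h))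
        (solve 2 (λ n e → n :+ ((con 1ℚ :* con 1ℚ :- (n :+ e)) :+ con ½ :* e :* (con ½ :* e))
           := (con 1ℚ :- con ½ :* e) :* (con 1ℚ :- con ½ :* e)) refl (norm (at q k)) ε))
    where
    h = ½ ℚ.* ε
    -- A rational radius without a square root: |q|² ≤ 1 - ε ≤ (1 - ε/2)².
    ρ = 1ℚ ℚ.- h
    ε≤1 : ε ℚ.≤ 1ℚ
    ε≤1 = ℚ.≤-trans (≤-by (norm (at q K)) (0≤norm (at q K)) (ℚ.+-comm ε (norm (at q K))))
                    (gap K ℕ.≤-refl)
    0≤ρ : 0ℚ ℚ.≤ ρ
    0≤ρ = x≤y⇒0≤y-x (ℚ.≤-trans (ℚ.<⇒≤ (½e<e 0<ε)) ε≤1)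
    ρ<1 : ρ ℚ.< 1ℚ
    ρ<1 = subst (ρ ℚ.<_) (solve 1 (λ h → con 1ℚ :- h :+ h := con 1ℚ) refl h)
      (subst (ℚ._< ρ ℚ.+ h) (ℚ.+-identityʳ ρ) (ℚ.+-monoʳ-< ρ (0<½* 0<ε)))

  -- Only from some index on, because recip truncates its argument below.
  at-/ : ∀ z w (w#0 : w #0) → ∃ λ K → ∀ k → K ℕ.≤ k →
    at (z / w [ w#0 ]) k ⊗ at w k ≡ at z k
  at-/ z w (c , 0<c , K , c≤) = K , λ k k≥ →
    let a = seq (re w) k
        b = seq (im w) k
        x = norm (at w k)
        s = recip-seq 0<c (seq (normSq w)) k
        sx≡1 : s ℚ.* x ≡ 1ℚ
        sx≡1 = trans
          (cong (s ℚ.*_) (sym (ℚ.p≤q⇒p⊔q≡q (subst (ℚ._≤ x) (ℚ.+-identityˡ c) (c≤ k k≥)))))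
          (ℚ.*-inverseˡ (c ℚ.⊔ x) {{0<⇒nonZero (0<⊔ 0<c x)}})
        inv : ((a ℚ.* s) ,ᵢ (ℚ.- b ℚ.* s)) ⊗ at w k ≡ 1ᵢ
        inv = cong₂ _,ᵢ_
          (trans (solve 3 (λ a b s → a :* s :* a :- (:- b) :* s :* b
                             := s :* (a :* a :+ b :* b)) refl a b s) sx≡1)
          (solve 3 (λ a b s → a :* s :* b :+ (:- b) :* s :* a := con 0ℚ) refl a b s)
    in trans (⊗-assoc (at z k) _ (at w k))
      (trans (cong (at z k ⊗_) inv) (trans (⊗-comm (at z k) 1ᵢ) (⊗-identityˡ (at z k))))

≈-refl : ∀ z → z ≈ z
≈-refl z = ≈ᵣ-refl (re z) , ≈ᵣ-refl (im z)
  where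
  ≈ᵣ-refl : ∀ x → x ≈ᵣ x
  ≈ᵣ-refl x ε 0<ε = 0 , λ n _ →
    subst (ℚ._< ε) (cong ℚ.∣_∣ (sym (ℚ.+-inverseʳ (seq x n)))) 0<ε

-- Convergence of the infinite products.

module _ {ρ} (0≤ρ : 0ℚ ℚ.≤ ρ) (ρ<1 : ρ ℚ.< 1ℚ) (a Q : ℂ) (K : ℕ)
  (a≤ρ : ∀ k → K ℕ.≤ k → ∣ at a k ∣≤ ρ) (Q≤ρ : ∀ k → K ℕ.≤ k → ∣ at Q k ∣≤ ρ) where

  private
    D = pochᵢ-modulus 0≤ρ ρ<1

    -- N is found before the entry k, since `pochᵢ-cauchy` depends on a and Q only through ρ. This
    -- uniformity gives both the diagonal and the convergence to it.
    tail-bound : ∀ e → 0ℚ ℚ.< e → ∃ λ N → ∀ {n m k} → N ℕ.≤ n → n ℕ.≤ m → K ℕ.≤ k →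
      ∣ at (poch a Q m) k ⊝ at (poch a Q n) k ∣≤ e
    tail-bound e 0<e = proj₁ N,small , λ {n} {m} {k} N≤n n≤m K≤k →
      subst₂ (λ x y → ∣ x ⊝ y ∣≤ e) (sym (at-poch a Q m k)) (sym (at-poch a Q n k))
        (∣∣≤-trans (pochᵢ-cauchy 0≤ρ ρ<1 0≤ρ ℚ.≤-refl (a≤ρ k K≤k) (Q≤ρ k K≤k) n≤m)
          (proj₂ N,small n N≤n))
      where
      N,small = powers-vanish 0≤ρ ρ<1 (D ℚ.* ρ) (0≤* (0≤pochᵢ-modulus 0≤ρ ρ<1) 0≤ρ) 0<e

    uniformlyCauchy : UniformlyCauchy (poch a Q)
    uniformlyCauchy e 0<e = proj₁ (tail-bound e 0<e) ℕ.⊔ K , λ n k n≥ k≥ →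
      proj₂ (tail-bound e 0<e) (ℕ.m≤m⊔n _ K) n≥ (ℕ.m⊔n≤o⇒n≤o _ K k≥)

  -- By construction `at poch∞ k` is `at (poch a Q k) k`, so bounds on finite products pass to the
  -- entries of the infinite one.
  poch∞ : ℂ
  poch∞ = diagonal (poch a Q) uniformlyCauchy

  poch∞-isPoch∞ : poch∞ isPoch∞[ a , Q ]
  poch∞-isPoch∞ = ⟶-intro (poch a Q) poch∞ λ e 0<e →
    proj₁ (tail-bound e 0<e) , λ n n≥ → n ℕ.⊔ K , λ k k≥ →
      ∣⊝∣≤-swap (at (poch a Q k) k) (at (poch a Q n) k)
        (proj₂ (tail-bound e 0<e) n≥ (ℕ.m⊔n≤o⇒m≤o n K k≥) (ℕ.m⊔n≤o⇒n≤o n K k≥))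

-- The telescoping sum

-- The computation inside one entry: u stands for the k-th approximation of q and every infinite
-- product is cut to k factors. Thus `product n` is the truncation of Gₙ.
module Telescoping (u : ℚ[i]) (k : ℕ) where

  Q : ℚ[i]
  Q = u ^ᵢ 2

  term partialSum product : ℕ → ℚ[i]
  term n = u ^ᵢ (2 ℕ.* n ℕ.+ 2) ⊗ pochᵢ (⊖ Q) Q n ⊗ pochᵢ (⊖ (u ^ᵢ (2 ℕ.* n ℕ.+ 3))) Q k
  product n = pochᵢ (⊖ Q) Q n ⊗ pochᵢ (⊖ (u ^ᵢ (2 ℕ.* n ℕ.+ 1))) Q k

  partialSum zero    = 0ᵢ
  partialSum (suc n) = partialSum n ⊕ term n

  error : ℕ → ℚ[i]
  error n = u ⊗ (product n ⊗ (u ^ᵢ (2 ℕ.* n ℕ.+ 1) ⊗ Q ^ᵢ k))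

  private
    u^2n+ : ∀ n r → u ^ᵢ (2 ℕ.* n ℕ.+ r) ≡ Q ^ᵢ n ⊗ u ^ᵢ r
    u^2n+ n r = trans (^ᵢ-homo u (2 ℕ.* n) r) (cong (_⊗ u ^ᵢ r) (sym (^ᵢ-assocʳ u 2 n)))

  -- From 1 + u²ⁿ⁺¹ - (1 + u²ⁿ⁺²) = (1 - u) u²ⁿ⁺¹; the error is the cost of
  -- truncating the infinite products after k factors.
  telescope : ∀ n → (1ᵢ ⊝ u) ⊗ term n ≡ u ⊗ (product n ⊝ product (suc n)) ⊕ error n
  telescope n = begin
    (1ᵢ ⊝ u) ⊗ term n
      ≡⟨ cong₂ (λ x y → (1ᵢ ⊝ u) ⊗ (x ⊗ p ⊗ pochᵢ y Q k)) (u^2n+ n 2) ⊖u^2n+3≡ ⟩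
    (1ᵢ ⊝ u) ⊗ (v ⊗ Q ⊗ p ⊗ T)
      ≡⟨ solve 4 (λ u v p T → let Q = u :* (u :* con 1ᵢ) in
           (con 1ᵢ :- u) :* (v :* Q :* p :* T)
           := u :* p :* ((con 1ᵢ :- (:- (v :* (u :* con 1ᵢ)))) :* T)
              :- u :* (p :* (con 1ᵢ :- (:- Q) :* v) :* T)) refl u v p T ⟩
    u ⊗ p ⊗ ((1ᵢ ⊝ a) ⊗ T) ⊝ u ⊗ (p ⊗ (1ᵢ ⊝ (⊖ Q) ⊗ v) ⊗ T)
      ≡⟨ cong (λ x → u ⊗ p ⊗ x ⊝ u ⊗ (p ⊗ (1ᵢ ⊝ (⊖ Q) ⊗ v) ⊗ T)) (pochᵢ-shift a Q k) ⟩
    u ⊗ p ⊗ (R ⊗ (1ᵢ ⊝ a ⊗ Q ^ᵢ k)) ⊝ u ⊗ (p ⊗ (1ᵢ ⊝ (⊖ Q) ⊗ v) ⊗ T)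
      ≡⟨ solve 6 (λ u p R w q y →
           u :* p :* (R :* (con 1ᵢ :- (:- w) :* q)) :- u :* y
           := u :* (p :* R :- y) :+ u :* (p :* R :* (w :* q)))
           refl u p R (v ⊗ u ^ᵢ 1) (Q ^ᵢ k) (p ⊗ (1ᵢ ⊝ (⊖ Q) ⊗ v) ⊗ T) ⟩
    u ⊗ (p ⊗ R ⊝ p ⊗ (1ᵢ ⊝ (⊖ Q) ⊗ v) ⊗ T) ⊕ u ⊗ (p ⊗ R ⊗ (v ⊗ u ^ᵢ 1 ⊗ Q ^ᵢ k))
      ≡⟨ cong₂ (λ x y → u ⊗ (p ⊗ pochᵢ (⊖ x) Q k ⊝ p ⊗ (1ᵢ ⊝ (⊖ Q) ⊗ v) ⊗ pochᵢ y Q k)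
                         ⊕ u ⊗ (p ⊗ pochᵢ (⊖ x) Q k ⊗ (x ⊗ Q ^ᵢ k)))
           (u^2n+ n 1) ⊖u^2[1+n]+1≡ ⟨
    u ⊗ (product n ⊝ product (suc n)) ⊕ error n ∎
    where
    open ℚ[i]-Solver
    open ≡-Reasoning
    v = Q ^ᵢ n
    p = pochᵢ (⊖ Q) Q n
    a = ⊖ (v ⊗ u ^ᵢ 1)
    T = pochᵢ (a ⊗ Q) Q k
    R = pochᵢ a Q k
    ⊖u^2n+3≡ : ⊖ (u ^ᵢ (2 ℕ.* n ℕ.+ 3)) ≡ a ⊗ Q
    ⊖u^2n+3≡ = trans (cong ⊖_ (u^2n+ n 3))
      (solve 3 (λ u v Q → :- (v :* (u :* Q)) := :- (v :* (u :* con 1ᵢ)) :* Q) refl u v Q)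
    ⊖u^2[1+n]+1≡ : ⊖ (u ^ᵢ (2 ℕ.* suc n ℕ.+ 1)) ≡ a ⊗ Q
    ⊖u^2[1+n]+1≡ = trans (cong ⊖_ (u^2n+ (suc n) 1))
      (solve 3 (λ u v Q → :- (Q :* v :* (u :* con 1ᵢ)) := :- (v :* (u :* con 1ᵢ)) :* Q)
        refl u v Q)

  module _ {ρ} (0≤ρ : 0ℚ ℚ.≤ ρ) (ρ<1 : ρ ℚ.< 1ℚ) (u≤ρ : ∣ u ∣≤ ρ) where
    private
      C = pochᵢ-upper 0≤ρ ρ<1
      D = pochᵢ-modulus 0≤ρ ρ<1
      0≤C = 0≤pochᵢ-upper 0≤ρ ρ<1
      0≤D = 0≤pochᵢ-modulus 0≤ρ ρ<1
      ρ≤1 = ℚ.<⇒≤ ρ<1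

      ρ^≤ρ : ∀ n → 1 ℕ.≤ n → ρ ^ℚ n ℚ.≤ ρ
      ρ^≤ρ n 1≤n = ℚ.≤-trans (^-antimonoʳ-≤ 0≤ρ ρ≤1 {1} {n} 1≤n) (ℚ.≤-reflexive (ℚ.*-identityʳ ρ))

      u^≤ρ : ∀ n → 1 ℕ.≤ n → ∣ u ^ᵢ n ∣≤ ρ
      u^≤ρ n 1≤n = ∣∣≤-trans (∣^∣≤ u≤ρ n) (ρ^≤ρ n 1≤n)

      Q≤ρ : ∣ Q ∣≤ ρ
      Q≤ρ = u^≤ρ 2 (ℕ.s≤s ℕ.z≤n)

      1≤2n+1 : ∀ n → 1 ℕ.≤ 2 ℕ.* n ℕ.+ 1
      1≤2n+1 n = ℕ.m≤n+m 1 (2 ℕ.* n)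

      product≤ : ∀ n → ∣ product n ∣≤ C ℚ.* C
      product≤ n = ∣⊗∣≤ (pochᵢ≤upper 0≤ρ ρ<1 0≤ρ ℚ.≤-refl (∣⊖∣≤ Q≤ρ) Q≤ρ n)
        (pochᵢ≤upper 0≤ρ ρ<1 0≤ρ ℚ.≤-refl (∣⊖∣≤ (u^≤ρ (2 ℕ.* n ℕ.+ 1) (1≤2n+1 n))) Q≤ρ k)

      error≤ : ∀ n → ∣ error n ∣≤ C ℚ.* C ℚ.* ρ ^ℚ k
      error≤ n = subst (∣ error n ∣≤_)
        (solve 2 (λ c r → con 1ℚ :* (c :* (con 1ℚ :* r)) := c :* r) refl (C ℚ.* C) (ρ ^ℚ k))
        (∣⊗∣≤ (∣∣≤-trans u≤ρ ρ≤1) (∣⊗∣≤ (product≤ n)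
          (∣⊗∣≤ (∣∣≤-trans (u^≤ρ (2 ℕ.* n ℕ.+ 1) (1≤2n+1 n)) ρ≤1) (∣^∣≤ Q≤ρ k))))
        where open +-*-Solver

    -- Summing `telescope` leaves n truncation errors, each at most C² ρᵏ. For fixed n their total
    -- vanishes as k grows, which is all that convergence of the n-th partial sum's entries needs.
    partialSum≈ : ∀ n → ∣ (1ᵢ ⊝ u) ⊗ partialSum n ⊝ u ⊗ (product 0 ⊝ product n) ∣≤
                        ι n ℚ.* (C ℚ.* C ℚ.* ρ ^ℚ k)
    partialSum≈ zero    = subst₂ ∣_∣≤_
      (solve 2 (λ u g → con 0ᵢ := (con 1ᵢ :- u) :* con 0ᵢ :- u :* (g :- g)) refl u (product 0))
      (sym (trans (cong (ℚ._* E) ι-zero) (ℚ.*-zeroˡ E)))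
      ∣0∣≤0
      where
      open ℚ[i]-Solver
      E = C ℚ.* C ℚ.* ρ ^ℚ k
    partialSum≈ (suc n) = subst₂ ∣_∣≤_ regroup
      (trans (S.solve 2 (λ m e → m S.:* e S.:+ e S.:= (S.con 1ℚ S.:+ m) S.:* e) refl (ι n) E)
             (cong (ℚ._* E) (sym (ι-suc n))))
      (∣⊕∣≤ (partialSum≈ n) (error≤ n))
      where
      open ℚ[i]-Solver
      module S = +-*-Solver
      E = C ℚ.* C ℚ.* ρ ^ℚ k
      s = partialSum n
      g₀ = product 0
      g₁ = product n
      g₂ = product (suc n)
      regroup : (1ᵢ ⊝ u) ⊗ s ⊝ u ⊗ (g₀ ⊝ g₁) ⊕ error n
                ≡ (1ᵢ ⊝ u) ⊗ (s ⊕ term n) ⊝ u ⊗ (g₀ ⊝ g₂)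
      regroup = begin
        (1ᵢ ⊝ u) ⊗ s ⊝ u ⊗ (g₀ ⊝ g₁) ⊕ error n
          ≡⟨ solve 6 (λ u s g₀ g₁ g₂ e →
               (con 1ᵢ :- u) :* s :- u :* (g₀ :- g₁) :+ e
               := (con 1ᵢ :- u) :* s :+ (u :* (g₁ :- g₂) :+ e) :- u :* (g₀ :- g₂))
               refl u s g₀ g₁ g₂ (error n) ⟩
        (1ᵢ ⊝ u) ⊗ s ⊕ (u ⊗ (g₁ ⊝ g₂) ⊕ error n) ⊝ u ⊗ (g₀ ⊝ g₂)
          ≡⟨ cong (λ x → (1ᵢ ⊝ u) ⊗ s ⊕ x ⊝ u ⊗ (g₀ ⊝ g₂)) (telescope n) ⟨
        (1ᵢ ⊝ u) ⊗ s ⊕ (1ᵢ ⊝ u) ⊗ term n ⊝ u ⊗ (g₀ ⊝ g₂)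
          ≡⟨ cong (_⊝ u ⊗ (g₀ ⊝ g₂)) (⊗-distribˡ-⊕ (1ᵢ ⊝ u) s (term n)) ⟨
        (1ᵢ ⊝ u) ⊗ (s ⊕ term n) ⊝ u ⊗ (g₀ ⊝ g₂) ∎
        where open ≡-Reasoning

    -- Write `product n` as c t. Then b - c t = (b - c) - c (t - 1), where b - c is a tail of one
    -- convergent product and t is near 1 because its parameter is -u²ⁿ⁺¹.
    product≈ : ∀ {n} → n ℕ.≤ k →
      ∣ pochᵢ (⊖ Q) Q k ⊝ product n ∣≤ (D ℚ.+ C ℚ.* D) ℚ.* ρ ^ℚ n
    product≈ {n} n≤k = ∣∣≤-trans
      (subst (∣_∣≤ _)
        (S.solve 3 (λ b c t → (b S.:- c) S.:+ (S.:- (c S.:* (t S.:- S.con 1ᵢ))) S.:= b S.:- c S.:* t)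
          refl (pochᵢ (⊖ Q) Q k) (pochᵢ (⊖ Q) Q n) (pochᵢ (⊖ (u ^ᵢ (2 ℕ.* n ℕ.+ 1))) Q k))
        (∣⊕∣≤
          (pochᵢ-cauchy 0≤ρ ρ<1 0≤ρ ℚ.≤-refl (∣⊖∣≤ Q≤ρ) Q≤ρ n≤k)
          (∣⊖∣≤ (∣⊗∣≤ (pochᵢ≤upper 0≤ρ ρ<1 0≤ρ ℚ.≤-refl (∣⊖∣≤ Q≤ρ) Q≤ρ n)
            -- Comparison with the empty product, with α = ρ²ⁿ⁺¹ supplying the decay in n.
            (pochᵢ-cauchy 0≤ρ ρ<1 (0≤^ 0≤ρ (2 ℕ.* n ℕ.+ 1)) (ρ^≤ρ (2 ℕ.* n ℕ.+ 1) (1≤2n+1 n))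
              (∣⊖∣≤ (∣^∣≤ u≤ρ (2 ℕ.* n ℕ.+ 1))) Q≤ρ {0} {k} ℕ.z≤n)))))
      (begin
        D ℚ.* ρ ℚ.* ρ ^ℚ n ℚ.+ C ℚ.* (D ℚ.* ρ ^ℚ (2 ℕ.* n ℕ.+ 1) ℚ.* 1ℚ)
          ≤⟨ ℚ.+-mono-≤
               (*-mono-≤ (0≤* 0≤D 0≤1) (0≤^ 0≤ρ n)
                 (*-mono-≤ {D} {D} {ρ} {1ℚ} 0≤D 0≤ρ ℚ.≤-refl ρ≤1) ℚ.≤-refl)
               (*-mono-≤ 0≤C (0≤* (0≤* 0≤D (0≤^ 0≤ρ (2 ℕ.* n ℕ.+ 1))) 0≤1) ℚ.≤-refl
                 (*-mono-≤ (0≤* 0≤D (0≤^ 0≤ρ n)) 0≤1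
                   (*-mono-≤ 0≤D (0≤^ 0≤ρ (2 ℕ.* n ℕ.+ 1)) ℚ.≤-refl
                     (^-antimonoʳ-≤ 0≤ρ ρ≤1 n≤2n+1)) ℚ.≤-refl)) ⟩
        D ℚ.* 1ℚ ℚ.* ρ ^ℚ n ℚ.+ C ℚ.* (D ℚ.* ρ ^ℚ n ℚ.* 1ℚ)
          ≡⟨ solve 3 (λ c d r → d :* con 1ℚ :* r :+ c :* (d :* r :* con 1ℚ)
                       := (d :+ c :* d) :* r) refl C D (ρ ^ℚ n) ⟩
        (D ℚ.+ C ℚ.* D) ℚ.* ρ ^ℚ n ∎)
      where
      module S = ℚ[i]-Solver
      open +-*-Solver
      open ℚ.≤-Reasoning
      n≤2n+1 : n ℕ.≤ 2 ℕ.* n ℕ.+ 1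
      n≤2n+1 = ℕ.≤-trans (ℕ.m≤m+n n (n ℕ.+ 0)) (ℕ.m≤m+n (2 ℕ.* n) 1)

-- Convergence of the series to the closed form.

theorem1p1 : (q : ℂ) → ∣ q ∣< 1ℝ →
    ∃ λ (F : ℂ) → ∃ λ (A : ℂ) → ∃ λ (B : ℂ) →
    F isFodEd[ q ] ×
    A isPoch∞[ - q , q ^ 2 ] ×
    B isPoch∞[ - (q ^ 2) , q ^ 2 ] ×
    Σ ((1ℂ - q) #0) λ 1-q#0 → Σ (A #0) λ A#0 →
    F ≈ (q * A) / (1ℂ - q) [ 1-q#0 ] * (1ℂ - B / A [ A#0 ])
theorem1p1 q ∣q∣<1 =
    -- The closed form itself is taken for `F`, so the equation is reflexivity and the content is
    -- that the series converges to it.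
    F , A , B , (T , T-isPoch∞ , ⟶-intro (λ n → (∑< n) term) F F-close) ,
    poch∞-isPoch∞ 0≤ρ ρ<1 (- q) (q ^ 2) K -q≤ρ q²≤ρ ,
    poch∞-isPoch∞ 0≤ρ ρ<1 (- (q ^ 2)) (q ^ 2) K -q²≤ρ q²≤ρ ,
    1-q#0 , A#0 , ≈-refl F
  where
  radius = ∣∣<1⇒radius {q} ∣q∣<1
  ρ = proj₁ radius
  0≤ρ = proj₁ (proj₂ radius)
  ρ<1 = proj₁ (proj₂ (proj₂ radius))
  K = proj₁ (proj₂ (proj₂ (proj₂ radius)))
  q≤ρ = proj₂ (proj₂ (proj₂ (proj₂ radius)))

  q^≤ρ : ∀ n → 1 ℕ.≤ n → ∀ k → K ℕ.≤ k → ∣ at (q ^ n) k ∣≤ ρ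
  q^≤ρ n 1≤n k K≤k = subst (∣_∣≤ ρ) (sym (at-^ q n k)) (∣∣≤-trans (∣^∣≤ (q≤ρ k K≤k) n)
    (ℚ.≤-trans (^-antimonoʳ-≤ 0≤ρ (ℚ.<⇒≤ ρ<1) {1} {n} 1≤n) (ℚ.≤-reflexive (ℚ.*-identityʳ ρ))))

  -q≤ρ : ∀ k → K ℕ.≤ k → ∣ at (- q) k ∣≤ ρ
  -q≤ρ k K≤k = ∣⊖∣≤ (q≤ρ k K≤k)
  q²≤ρ = q^≤ρ 2 (ℕ.s≤s ℕ.z≤n)
  -q²≤ρ : ∀ k → K ℕ.≤ k → ∣ at (- (q ^ 2)) k ∣≤ ρ
  -q²≤ρ k K≤k = ∣⊖∣≤ (q²≤ρ k K≤k)
  -q²ⁿ⁺³≤ρ : ∀ n k → K ℕ.≤ k → ∣ at (- (q ^ (2 ℕ.* n ℕ.+ 3))) k ∣≤ ρ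
  -q²ⁿ⁺³≤ρ n k K≤k = ∣⊖∣≤
    (q^≤ρ (2 ℕ.* n ℕ.+ 3) (ℕ.≤-trans (ℕ.s≤s ℕ.z≤n) (ℕ.m≤n+m 3 (2 ℕ.* n))) k K≤k)

  A B : ℂ
  A = poch∞ 0≤ρ ρ<1 (- q) (q ^ 2) K -q≤ρ q²≤ρ
  B = poch∞ 0≤ρ ρ<1 (- (q ^ 2)) (q ^ 2) K -q²≤ρ q²≤ρ

  T : ℕ → ℂ
  T n = poch∞ 0≤ρ ρ<1 (- (q ^ (2 ℕ.* n ℕ.+ 3))) (q ^ 2) K (-q²ⁿ⁺³≤ρ n) q²≤ρ

  T-isPoch∞ : ∀ n → T n isPoch∞[ - (q ^ (2 ℕ.* n ℕ.+ 3)) , q ^ 2 ]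
  T-isPoch∞ n = poch∞-isPoch∞ 0≤ρ ρ<1 (- (q ^ (2 ℕ.* n ℕ.+ 3))) (q ^ 2) K (-q²ⁿ⁺³≤ρ n) q²≤ρ

  1-q#0 : (1ℂ - q) #0
  1-q#0 = #0-intro {1ℂ - q} K (0<1-x ρ<1) λ k K≤k → ≤∣1⊝∣ (ℚ.<⇒≤ ρ<1) (q≤ρ k K≤k)

  A#0 : A #0
  -- The k-th entry of `A` is a product of k factors, and the lower bound on such products does not
  -- depend on k.
  A#0 = #0-intro {A} K (0<pochᵢ-lower 0≤ρ ρ<1) λ k K≤k →
    subst (pochᵢ-lower 0≤ρ ρ<1 ≤∣_∣) (sym (at-poch (- q) (q ^ 2) k k))
      (pochᵢ≥lower 0≤ρ ρ<1 0≤ρ ℚ.≤-refl (-q≤ρ k K≤k) (q²≤ρ k K≤k) k)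

  F : ℂ
  F = (q * A) / (1ℂ - q) [ 1-q#0 ] * (1ℂ - B / A [ A#0 ])

  term : ℕ → ℂ
  term n = q ^ (2 ℕ.* n ℕ.+ 2) * poch (- (q ^ 2)) (q ^ 2) n * T n

  at-term : ∀ k n → at (term n) k ≡ Telescoping.term (at q k) k n
  at-term k n = cong₂ _⊗_
    (cong₂ _⊗_ (at-^ q (2 ℕ.* n ℕ.+ 2) k) (at-poch (- (q ^ 2)) (q ^ 2) n k))
    (trans (at-poch (- (q ^ (2 ℕ.* n ℕ.+ 3))) (q ^ 2) k k)
      (cong (λ x → pochᵢ (⊖ x) (at (q ^ 2) k) k) (at-^ q (2 ℕ.* n ℕ.+ 3) k)))

  at-partialSum : ∀ k n → at ((∑< n) term) k ≡ Telescoping.partialSum (at q k) k n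
  at-partialSum k zero    = refl
  at-partialSum k (suc n) = cong₂ _⊕_ (at-partialSum k n) (at-term k n)

  -- Clearing both denominators turns the closed form into the telescoped limit q (A - B).
  F-equation : ∃ λ M → ∀ k → M ℕ.≤ k →
    (1ᵢ ⊝ at q k) ⊗ at F k ≡ at q k ⊗ (at A k ⊝ at B k)
  F-equation = M₁ ℕ.⊔ M₂ , λ k k≥ →
    let u = at q k
        a = at A k
        X = at ((q * A) / (1ℂ - q) [ 1-q#0 ]) k
        Y = at (B / A [ A#0 ]) k
    in begin
      (1ᵢ ⊝ u) ⊗ (X ⊗ (1ᵢ ⊝ Y))
        ≡⟨ solve 3 (λ u x y → (con 1ᵢ :- u) :* (x :* (con 1ᵢ :- y))
             := x :* (con 1ᵢ :- u) :* (con 1ᵢ :- y)) refl u X Y ⟩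
      X ⊗ (1ᵢ ⊝ u) ⊗ (1ᵢ ⊝ Y)
        ≡⟨ cong (_⊗ (1ᵢ ⊝ Y)) (proj₂ F₁ k (ℕ.m⊔n≤o⇒m≤o M₁ M₂ k≥)) ⟩
      u ⊗ a ⊗ (1ᵢ ⊝ Y)
        ≡⟨ solve 3 (λ u a y → u :* a :* (con 1ᵢ :- y) := u :* (a :- y :* a)) refl u a Y ⟩
      u ⊗ (a ⊝ Y ⊗ a)
        ≡⟨ cong (λ b → u ⊗ (a ⊝ b)) (proj₂ F₂ k (ℕ.m⊔n≤o⇒n≤o M₁ M₂ k≥)) ⟩
      u ⊗ (a ⊝ at B k) ∎
    where
    open ℚ[i]-Solver
    open ≡-Reasoning
    F₁ = at-/ (q * A) (1ℂ - q) 1-q#0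
    F₂ = at-/ B A A#0
    M₁ = proj₁ F₁
    M₂ = proj₁ F₂

  -- The order of choice matters: n is first taken large enough that `product n` is near its limit,
  -- and only then k, depending on n, large enough that n truncation errors are small.
  F-close : ∀ e → 0ℚ ℚ.< e → ∃ λ N → ∀ n → N ℕ.≤ n →
    ∃ λ M → ∀ k → M ℕ.≤ k → ∣ at ((∑< n) term) k ⊝ at F k ∣≤ e
  F-close e 0<e = proj₁ product-small , λ n n≥ →
    let error-small = powers-vanish 0≤ρ ρ<1 (ι n ℚ.* (C ℚ.* C))
                        (0≤* (0≤ι n) (0≤* 0≤C 0≤C)) 0<h
        M₁ = proj₁ error-small
        M₂ = proj₁ F-equation
    in (M₁ ℕ.⊔ M₂) ℕ.⊔ (n ℕ.⊔ K) , λ k k≥ →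
      let k≥M₁⊔M₂ = ℕ.m⊔n≤o⇒m≤o (M₁ ℕ.⊔ M₂) (n ℕ.⊔ K) k≥
          k≥n⊔K   = ℕ.m⊔n≤o⇒n≤o (M₁ ℕ.⊔ M₂) (n ℕ.⊔ K) k≥
      in subst (λ s → ∣ s ⊝ at F k ∣≤ e) (sym (at-partialSum k n))
        (close n k (proj₂ product-small n n≥)
          (ℚ.≤-trans (ℚ.≤-reflexive (sym (ℚ.*-assoc (ι n) (C ℚ.* C) (ρ ^ℚ k))))
            (proj₂ error-small k (ℕ.m⊔n≤o⇒m≤o M₁ M₂ k≥M₁⊔M₂)))
          (proj₂ F-equation k (ℕ.m⊔n≤o⇒n≤o M₁ M₂ k≥M₁⊔M₂))
          (ℕ.m⊔n≤o⇒m≤o n K k≥n⊔K) (ℕ.m⊔n≤o⇒n≤o n K k≥n⊔K))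
    where
    C = pochᵢ-upper 0≤ρ ρ<1
    D = pochᵢ-modulus 0≤ρ ρ<1
    0≤C = 0≤pochᵢ-upper 0≤ρ ρ<1
    0≤D = 0≤pochᵢ-modulus 0≤ρ ρ<1
    0<1-ρ = 0<1-x ρ<1
    -- Half for each of the two errors; the factor 1 - ρ pays for cancelling 1 - q, whose entries
    -- have modulus at least 1 - ρ.
    h = ½ ℚ.* ((1ℚ ℚ.- ρ) ℚ.* e)
    0<h : 0ℚ ℚ.< h
    0<h = 0<½* (0<* 0<1-ρ 0<e)
    product-small = powers-vanish 0≤ρ ρ<1 (D ℚ.+ C ℚ.* D) (0≤+ 0≤D (0≤* 0≤C 0≤D)) 0<h

    -- Multiplied by 1 - u, the difference is the telescoping error of the partial sum plus u times
    -- the distance of `product n` from the k-th entry of `B`; each part is at most h.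
    close : ∀ n k → (D ℚ.+ C ℚ.* D) ℚ.* ρ ^ℚ n ℚ.≤ h → ι n ℚ.* (C ℚ.* C ℚ.* ρ ^ℚ k) ℚ.≤ h →
      (1ᵢ ⊝ at q k) ⊗ at F k ≡ at q k ⊗ (at A k ⊝ at B k) → n ℕ.≤ k → K ℕ.≤ k →
      ∣ Telescoping.partialSum (at q k) k n ⊝ at F k ∣≤ e
    close n k product≤h error≤h F≡ n≤k K≤k =
      ∣∣≤-cancel 0<1-ρ (≤∣1⊝∣ (ℚ.<⇒≤ ρ<1) u≤ρ)
        (subst₂ ∣_∣≤_ regroup (trans (cong (h ℚ.+_) (ℚ.*-identityˡ h)) (½e+½e≡e _))
          (∣⊕∣≤ (∣∣≤-trans (partialSum≈ 0≤ρ ρ<1 u≤ρ n) error≤h)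
            (∣⊗∣≤ (∣∣≤-trans u≤ρ (ℚ.<⇒≤ ρ<1)) (∣∣≤-trans (product≈ 0≤ρ ρ<1 u≤ρ n≤k) product≤h))))
        (ℚ.<⇒≤ 0<e)
      where
      u = at q k
      open Telescoping u k hiding (term)
      u≤ρ = q≤ρ k K≤k
      s = partialSum n
      b = pochᵢ (⊖ Q) Q k
      F≡product : (1ᵢ ⊝ u) ⊗ at F k ≡ u ⊗ (product 0 ⊝ b)
      F≡product = trans F≡ (cong₂ (λ x y → u ⊗ (x ⊝ y))
        -- The k-th entry of `A` is `product 0` up to the empty first product and the exponent 1 of
        -- u.
        (trans (at-poch (- q) (q ^ 2) k k)
          (trans (cong (λ x → pochᵢ (⊖ x) Q k) (solve 1 (λ u → u := u :* con 1ᵢ) refl u))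
            (sym (⊗-identityˡ (pochᵢ (⊖ (u ^ᵢ 1)) Q k)))))
        (at-poch (- (q ^ 2)) (q ^ 2) k k))
        where open ℚ[i]-Solver
      regroup : (1ᵢ ⊝ u) ⊗ s ⊝ u ⊗ (product 0 ⊝ product n) ⊕ u ⊗ (b ⊝ product n)
                ≡ (1ᵢ ⊝ u) ⊗ (s ⊝ at F k)
      regroup = begin
        (1ᵢ ⊝ u) ⊗ s ⊝ u ⊗ (product 0 ⊝ product n) ⊕ u ⊗ (b ⊝ product n)
          ≡⟨ solve 5 (λ u s g₀ g b →
               (con 1ᵢ :- u) :* s :- u :* (g₀ :- g) :+ u :* (b :- g)
               := (con 1ᵢ :- u) :* s :- u :* (g₀ :- b)) refl u s (product 0) (product n) b ⟩
        (1ᵢ ⊝ u) ⊗ s ⊝ u ⊗ (product 0 ⊝ b)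
          ≡⟨ cong ((1ᵢ ⊝ u) ⊗ s ⊝_) F≡product ⟨
        (1ᵢ ⊝ u) ⊗ s ⊝ (1ᵢ ⊝ u) ⊗ at F k
          ≡⟨ solve 3 (λ u s f → (con 1ᵢ :- u) :* s :- (con 1ᵢ :- u) :* f
               := (con 1ᵢ :- u) :* (s :- f)) refl u s (at F k) ⟩
        (1ᵢ ⊝ u) ⊗ (s ⊝ at F k) ∎
        where
        open ℚ[i]-Solver
        open ≡-Reasoning
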